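{- Let $(f,M)$ be a polymatroid which has a non-principal modular cut. Then $(f,M)$ is not sticky.
   Context: All sets are finite. A polymatroid $(f,M)$ is a finite set $M$ with a real-valued function $f$ on subsets of $M$ (with $f(\emptyset)=0$) that is non-negative, monotone ($A\subseteq B\Rightarrow f(A)\le f(B)$) and submodular ($f(A)+f(B)\ge f(A\cap B)+f(A\cup B)$). A subset $F\subseteq M$ is a flat if every proper superset of $F$ in $M$ has strictly larger rank. The modular defect of $A,B$ is $\delta(A,B)=f(A)+f(B)-f(A\cap B)-f(A\cup B)\ge 0$; $(A,B)$ is a modular pair if $\delta(A,B)=0$. A modular cut is a collection $\mathcal M$ of flats such that (i) if $F_1\in\mathcal M$ and $F_1\subseteq F_2$ with $F_2$ a flat then $F_2\in\mathcal M$, and (ii) if $F_1,F_2\in\mathcal M$ form a modular pair then $F_1\cap F_2\in\mathcal M$. The modular cut $\mathcal M$ is principal if the intersection of all elements of $\mathcal M$ belongs to $\mathcal M$ (this includes the case $\mathcal M=\emptyset$). A polymatroid $(g,N)$ is an extension of $(f,M)$ if $N\supseteq M$ and $g(A)=f(A)$ for all $A\subseteq M$. $(f,M)$ is sticky if for any two extensions $(g_1,N_1)$, $(g_2,N_2)$ of $(f,M)$ with $N_1\cap N_2=M$ there is a polymatroid $(h,N_1\cup N_2)$ (an amalgam) which is an extension of both $(g_1,N_1)$ and $(g_2,N_2)$. -}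

module Defs where

open import Level using (0ℓ)
open import Data.Nat using (ℕ) renaming (_+_ to _+ℕ_)
open import Data.Fin using (Fin)
open import Data.Bool using (Bool; false)
open import Data.Vec using (Vec; _++_; replicate)
open import Data.Fin.Subset using (Subset; _⊆_; _⊂_; _∩_; _∪_; _∈_)
open import Data.Product using (Σ; ∃; _×_; _,_)
open import Data.Sum using (_⊎_)
open import Relation.Nullary using (¬_)
open import Relation.Binary.PropositionalEquality using (_≡_)
open import Relation.Binary.Structures using (IsStrictTotalOrder)
open import Algebra.Structures using (IsCommutativeRing)

-- The real numbers, axiomatised as a complete ordered field
-- (categorical: any model is isomorphic to ℝ).  Equality is _≡_.

record RealField : Set₁ where
  infixl 7 _*_
  infixl 6 _+_
  infix  4 _<_ _≤_
  field
    Carrier : Set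
    _+_ _*_ : Carrier → Carrier → Carrier
    -_      : Carrier → Carrier
    0# 1#   : Carrier
    _<_     : Carrier → Carrier → Set
    isCommutativeRing : IsCommutativeRing _≡_ _+_ _*_ -_ 0# 1#
    0≢1     : ¬ (0# ≡ 1#)
    inverse : ∀ x → ¬ (x ≡ 0#) → ∃ λ y → x * y ≡ 1#
    isStrictTotalOrder : IsStrictTotalOrder _≡_ _<_
    +-mono-< : ∀ {x y} z → x < y → x + z < y + z
    *-pos    : ∀ {x y} → 0# < x → 0# < y → 0# < x * y

  _≤_ : Carrier → Carrier → Set
  x ≤ y = (x < y) ⊎ (x ≡ y)

  IsUpperBound : (Carrier → Set) → Carrier → Set
  IsUpperBound P b = ∀ x → P x → x ≤ b

  field
    completeness : (P : Carrier → Set) → ∃ P → ∃ (IsUpperBound P) →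
                   ∃ λ s → IsUpperBound P s × (∀ b → IsUpperBound P b → s ≤ b)

-- Polymatroids.  A finite ground set M is modelled as Fin m; subsets of
-- it are Data.Fin.Subset m.  An extension to N ⊇ M is modelled with
-- N = M ⊎ (k new elements), i.e. ground set Fin (m + k), a subset of N
-- being (its part in M) ++ (its part among the new elements).

module Poly (ℝ : RealField) where
  open RealField ℝ

  record IsPolymatroid {m : ℕ} (f : Subset m → Carrier) : Set where
    field
      empty       : f (replicate m false) ≡ 0#
      nonneg      : ∀ A → 0# ≤ f A
      monotone    : ∀ A B → A ⊆ B → f A ≤ f B
      submodular  : ∀ A B → f (A ∩ B) + f (A ∪ B) ≤ f A + f B

  module _ {m : ℕ} (f : Subset m → Carrier) where

    IsFlat : Subset m → Set
    IsFlat F = ∀ B → F ⊂ B → f F < f B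

    δ : Subset m → Subset m → Carrier
    δ A B = f A + f B + - f (A ∩ B) + - f (A ∪ B)

    IsModularPair : Subset m → Subset m → Set
    IsModularPair A B = δ A B ≡ 0#

    record IsModularCut (𝓜 : Subset m → Set) : Set where
      field
        flats    : ∀ F → 𝓜 F → IsFlat F
        up-close : ∀ F₁ F₂ → 𝓜 F₁ → F₁ ⊆ F₂ → IsFlat F₂ → 𝓜 F₂
        modular  : ∀ F₁ F₂ → 𝓜 F₁ → 𝓜 F₂ → IsModularPair F₁ F₂ → 𝓜 (F₁ ∩ F₂)

    IsIntersectionOf : (Subset m → Set) → Subset m → Set
    IsIntersectionOf 𝓜 X =
      ∀ i → (i ∈ X → ∀ F → 𝓜 F → i ∈ F) × ((∀ F → 𝓜 F → i ∈ F) → i ∈ X)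

    IsPrincipal : (Subset m → Set) → Set
    IsPrincipal 𝓜 = (∀ F → ¬ 𝓜 F) ⊎ (∀ X → IsIntersectionOf 𝓜 X → 𝓜 X)

    HasNonPrincipalModularCut : Set₁
    HasNonPrincipalModularCut =
      Σ (Subset m → Set) λ 𝓜 → IsModularCut 𝓜 × ¬ IsPrincipal 𝓜

    record IsExtension (k : ℕ) (g : Subset (m +ℕ k) → Carrier) : Set where
      field
        polymatroid : IsPolymatroid g
        restricts   : ∀ A → g (A ++ replicate k false) ≡ f A

    -- Sticky: any two extensions with N₁ ∩ N₂ = M (new elements disjoint)
    -- have an amalgam on N₁ ∪ N₂ = M ⊎ Fin k₁ ⊎ Fin k₂.
    Sticky : Set
    Sticky =
      ∀ (k₁ k₂ : ℕ) (g₁ : Subset (m +ℕ k₁) → Carrier) (g₂ : Subset (m +ℕ k₂) → Carrier) →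
      IsExtension k₁ g₁ → IsExtension k₂ g₂ →
      Σ (Subset (m +ℕ (k₁ +ℕ k₂)) → Carrier) λ h →
        IsPolymatroid h ×
        (∀ (A : Subset m) (B₁ : Subset k₁) → h (A ++ (B₁ ++ replicate k₂ false)) ≡ g₁ (A ++ B₁)) ×
        (∀ (A : Subset m) (B₂ : Subset k₂) → h (A ++ (replicate k₁ false ++ B₂)) ≡ g₂ (A ++ B₂))

{-# OPTIONS --safe #-}

-- Let 𝓜 be the modular cut and let A, B ∈ 𝓜 have A ∩ B = L ∉ 𝓜 and the least modular
-- defect t among all such pairs.  Put f̂ X = min { f F : X ⊆ F ∈ 𝓜 }.  Leastness of t
-- makes min (f , f̂ + s) submodular for all s ≥ -t, and forces f̂ L = f L + t + p, p > 0.
--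
-- The first extension adds a point e lying in every F ∈ 𝓜 but not in L.  The second adds a
-- pool of n + 1 interchangeable elements of rank p that are independent over L, while n of them
-- lose rank t over each member of 𝓜: thus A and B become a modular pair over any n of them.
-- Hence in an amalgam e lies in the closure of L ∪ S for every S of size n.  Since L ∪ S ∪ x
-- and L ∪ S ∪ y form a modular pair, e then lies in the closure of L ∪ S for every S of size
-- n - 1, n - 2, ..., 0: a contradiction.
--
-- The delicate point is the last pool element: submodularity wants it to lose at least as much
-- rank over the members of 𝓜 as the others, but the family min (f , f̂ + s), which produces
-- the loss, is exhausted at s = -t.  So a small extra loss η is produced by contracting, for
-- each F ∈ 𝓜, an element of rank η placed freely on F; the pool is then taken so large that
-- each of its elements has to lose only η.
module Submission where

open import Defs
open import Algebra.Bundles using (CommutativeRing)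
open import Data.Bool.Base using (Bool; true; false; _∧_; _∨_)
open import Data.Empty using (⊥-elim) renaming (⊥ to Empty)
open import Data.Fin.Subset using (Subset; _⊆_; _⊂_; _∩_; _∪_; ∁; ∣_∣; ⊥; ⊤)
open import Data.Fin.Subset.Induction using (⊃-wellFounded; Acc; acc)
open import Data.Fin.Subset.Properties
open import Data.List.Base as List using (List; []; _∷_; foldr; length; cartesianProduct)
open import Data.List.Membership.Propositional using (_∈_)
open import Data.List.Membership.Propositional.Properties
  using (∈-++⁺ˡ; ∈-++⁺ʳ; ∈-map⁺; ∈-filter⁺; ∈-filter⁻; ∈-cartesianProduct⁺)
open import Data.List.Relation.Unary.Any using (here; there)
open import Data.Nat using (ℕ)
open import Data.Nat.Base as ℕ using (zero; suc)
import Data.Nat.Properties as ℕ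
open import Data.Product using (∃; ∃₂; _×_; _,_; proj₁; proj₂)
open import Data.Sum using (inj₁; inj₂)
open import Data.Vec.Base using ([]; _∷_; _++_; take; drop; replicate)
open import Data.Vec.Properties using (take-zipWith; drop-zipWith; zipWith-++)
open import Relation.Binary.Bundles using (StrictTotalOrder; DecTotalOrder)
open import Relation.Binary.Definitions using (tri<; tri≈; tri>)
open import Relation.Binary.PropositionalEquality
open import Relation.Nullary using (¬_; contradiction; Dec; yes; no)
open import Relation.Nullary.Decidable using (_×-dec_; ¬?; ¬¬-excluded-middle)
import Algebra.Construct.NaturalChoice.Min as Min
import Algebra.Lattice.Properties.BooleanAlgebra as BA
import Algebra.Properties.Monoid.Mult as Mult
import Algebra.Solver.CommutativeMonoid as CMSolver
import Relation.Binary.Properties.StrictTotalOrder as STO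

-- Arithmetic and order in the real field.

module Reals (ℝ : RealField) where
  open RealField ℝ public
    using (Carrier; _+_; -_; 0#; 1#; _<_; _≤_; +-mono-<; completeness; isStrictTotalOrder)
  open RealField ℝ using (_*_; isCommutativeRing; inverse)

  commutativeRing : CommutativeRing _ _
  commutativeRing = record { isCommutativeRing = isCommutativeRing }

  strictTotalOrder : StrictTotalOrder _ _ _
  strictTotalOrder = record { isStrictTotalOrder = isStrictTotalOrder }

  open CommutativeRing commutativeRing public
    using (+-comm; +-assoc; +-identityˡ; +-identityʳ; -‿inverseˡ; -‿inverseʳ; +-monoid; +-commutativeMonoid)
  open StrictTotalOrder strictTotalOrder public
    using (compare) renaming (irrefl to <-irrefl; trans to <-trans)
  open DecTotalOrder (STO.decTotalOrder strictTotalOrder) public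
    using (totalOrder; total)
    renaming (refl to ≤-refl; reflexive to ≤-reflexive; trans to ≤-trans; antisym to ≤-antisym)
  open Min totalOrder public
    using (_⊓_; x⊓y≤x; x⊓y≤y; ⊓-glb; ⊓-sel; ⊓-mono-≤)
  open Mult +-monoid public
    using (×-homo-+) renaming (_×_ to infixr 8 _·_)
  open CMSolver +-commutativeMonoid public using (solve; _⊕_; _⊜_; id)

  <⇒≱ : ∀ {x y} → x < y → ¬ y ≤ x
  <⇒≱ x<y (inj₁ y<x)  = <-irrefl refl (<-trans x<y y<x)
  <⇒≱ x<y (inj₂ refl) = <-irrefl refl x<y

  ≮⇒≥ : ∀ {x y} → ¬ x < y → y ≤ x
  ≮⇒≥ {x} {y} x≮y with compare x y
  ... | tri< x<y _ _ = contradiction x<y x≮y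
  ... | tri≈ _ x≡y _ = inj₂ (sym x≡y)
  ... | tri> _ _ y<x = inj₁ y<x

  <-≤-trans : ∀ {x y z} → x < y → y ≤ z → x < z
  <-≤-trans x<y (inj₁ y<z)  = <-trans x<y y<z
  <-≤-trans x<y (inj₂ refl) = x<y

  ≤-<-trans : ∀ {x y z} → x ≤ y → y < z → x < z
  ≤-<-trans (inj₁ x<y)  y<z = <-trans x<y y<z
  ≤-<-trans (inj₂ refl) y<z = y<z

  ≤∧≢⇒< : ∀ {x y} → x ≤ y → ¬ x ≡ y → x < y
  ≤∧≢⇒< (inj₁ x<y) _   = x<y
  ≤∧≢⇒< (inj₂ x≡y) x≢y = contradiction x≡y x≢y

  +-monoˡ-≤ : ∀ {x y} z → x ≤ y → x + z ≤ y + z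
  +-monoˡ-≤ z (inj₁ x<y)  = inj₁ (+-mono-< z x<y)
  +-monoˡ-≤ z (inj₂ refl) = inj₂ refl

  +-monoʳ-≤ : ∀ {x y} z → x ≤ y → z + x ≤ z + y
  +-monoʳ-≤ {x} {y} z x≤y = subst₂ _≤_ (+-comm x z) (+-comm y z) (+-monoˡ-≤ z x≤y)

  _≤?_ : ∀ x y → Dec (x ≤ y)
  _≤?_ = DecTotalOrder._≤?_ (STO.decTotalOrder strictTotalOrder)

  ≰⇒> : ∀ {x y} → ¬ x ≤ y → y < x
  ≰⇒> {x} {y} x≰y with compare x y
  ... | tri< x<y _ _ = contradiction (inj₁ x<y) x≰y
  ... | tri≈ _ x≡y _ = contradiction (inj₂ x≡y) x≰y
  ... | tri> _ _ y<x = y<x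

  infixr 6 _⊹_
  _⊹_ : ∀ {x y u v} → x ≤ y → u ≤ v → x + u ≤ y + v
  _⊹_ {y = y} {u = u} x≤y u≤v = ≤-trans (+-monoˡ-≤ u x≤y) (+-monoʳ-≤ y u≤v)

  infixr 6 _⊹<_
  _⊹<_ : ∀ {x y u v} → x < y → u ≤ v → x + u < y + v
  _⊹<_ {y = y} {u = u} x<y u≤v = <-≤-trans (+-mono-< u x<y) (+-monoʳ-≤ y u≤v)

  +-cancelʳ-≤ : ∀ z {x y} → x + z ≤ y + z → x ≤ y
  +-cancelʳ-≤ z h = ≮⇒≥ λ y<x → <⇒≱ (+-mono-< z y<x) h

  +-cancelʳ-< : ∀ z {x y} → x + z < y + z → x < y
  +-cancelʳ-< z {x} {y} h with compare x y
  ... | tri< x<y _ _  = x<y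
  ... | tri≈ _ refl _ = contradiction h (<-irrefl refl)
  ... | tri> _ _ y<x  = contradiction (inj₁ (+-mono-< z y<x)) (<⇒≱ h)

  -- Known inequalities are added up to x ≤ y.  Nothing is ever subtracted, so the
  -- commutative monoid solver can check the identity that remains.
  by : ∀ {a b x y} → x ≤ y → a + y ≡ b + x → a ≤ b
  by {a} {b} {x} {y} x≤y eq =
    +-cancelʳ-≤ x (subst (a + x ≤_) eq (+-monoʳ-≤ a x≤y))

  by-< : ∀ {a b x y} → x < y → a + y ≡ b + x → a < b
  by-< {a} {b} {x} {y} x<y eq =
    +-cancelʳ-< x (subst₂ _<_ (+-comm x a) (trans (+-comm y a) eq) (+-mono-< a x<y))

  ⊓-elim : (P : Carrier → Set) → ∀ {x y} → P x → P y → P (x ⊓ y)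
  ⊓-elim P {x} {y} px py with ⊓-sel x y
  ... | inj₁ e = subst P (sym e) px
  ... | inj₂ e = subst P (sym e) py

  difference : ∀ {x y} → x < y → ∃ λ d → 0# < d × x + d ≡ y
  difference {x} {y} x<y = d , by-< x<y (trans (+-identityˡ y) (sym d+x≡y)) , trans (+-comm x d) d+x≡y
    where
    d = y + - x
    d+x≡y : d + x ≡ y
    d+x≡y = trans (+-assoc y (- x) x) (trans (cong (y +_) (-‿inverseˡ x)) (+-identityʳ y))

  ·-nonneg : ∀ n {x} → 0# ≤ x → 0# ≤ n · x
  ·-nonneg zero    _   = ≤-refl
  ·-nonneg (suc n) 0≤x = subst (_≤ _ + n · _) (+-identityˡ 0#) (0≤x ⊹ ·-nonneg n 0≤x)

  ·-monoʳ-≤ : ∀ n {x y} → x ≤ y → n · x ≤ n · y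
  ·-monoʳ-≤ zero    _   = ≤-refl
  ·-monoʳ-≤ (suc n) x≤y = x≤y ⊹ ·-monoʳ-≤ n x≤y

  -- If all multiples of `x` stayed below `y`, they would have a supremum `s`; each `suc n · x` is
  -- at most `s`, so `s - x` would be an upper bound too. The negated form suffices because it
  -- serves to prove a negation.
  archimedean : ∀ {x y} → 0# < x → ¬ (∀ n → n · x < y)
  archimedean {x} {y} 0<x h = <⇒≱ 0<x (by s+x≤s (trans (+-comm x s) (sym (+-identityˡ (s + x)))))
    where
    sup = completeness (λ z → ∃ λ n → z ≡ n · x) (0# , 0 , refl) (y , λ where _ (n , refl) → inj₁ (h n))
    s   = proj₁ sup
    0≤x-x : 0# ≤ x + - x
    0≤x-x = ≤-reflexive (sym (-‿inverseʳ x))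
    s-x-bound : ∀ z → (∃ λ n → z ≡ n · x) → z ≤ s + - x
    s-x-bound _ (n , refl) = by (proj₁ (proj₂ sup) _ (suc n , refl) ⊹ 0≤x-x)
      (solve 4 (λ nx s x x⁻ → nx ⊕ (s ⊕ (x ⊕ x⁻)) ⊜ (s ⊕ x⁻) ⊕ ((x ⊕ nx) ⊕ id)) refl (n · x) s x (- x))
    s+x≤s : s + x ≤ s
    s+x≤s = by (proj₂ (proj₂ sup) _ s-x-bound ⊹ ≤-reflexive (-‿inverseʳ x))
      (solve 3 (λ s x x⁻ → (s ⊕ x) ⊕ ((s ⊕ x⁻) ⊕ id) ⊜ s ⊕ (s ⊕ (x ⊕ x⁻))) refl s x (- x))

  halve : ∀ {x} → 0# < x → ∃ λ y → 0# < y × y + y ≡ x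
  halve {x} 0<x = y , 0<y , y+y≡x
    where
    open CommutativeRing commutativeRing using (distribˡ; distribʳ; *-identityʳ)
    0<x+x : 0# < x + x
    0<x+x = <-trans 0<x (subst (_< x + x) (+-identityˡ x) (+-mono-< x 0<x))
    x+x⁻¹ = inverse (x + x) λ e → <-irrefl (sym e) 0<x+x
    z = proj₁ x+x⁻¹
    -- As `z` inverts `x + x`, this is x²/(2x); that `x + x` is invertible follows from `0 < x`.
    y = x * (x * z)
    y+y≡x : y + y ≡ x
    y+y≡x = begin
      x * (x * z) + x * (x * z) ≡⟨ distribˡ x (x * z) (x * z) ⟨
      x * (x * z + x * z)       ≡⟨ cong (x *_) (distribʳ z x x) ⟨
      x * ((x + x) * z)         ≡⟨ cong (x *_) (proj₂ x+x⁻¹) ⟩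
      x * 1#                    ≡⟨ *-identityʳ x ⟩
      x                         ∎
      where open ≡-Reasoning
    0<y : 0# < y
    0<y = ≰⇒> λ y≤0 → <⇒≱ 0<x (subst₂ _≤_ y+y≡x (+-identityˡ 0#) (y≤0 ⊹ y≤0))

  small-fraction : ∀ n {x} → 0# < x → ∃ λ y → 0# < y × suc n · y ≤ x
  small-fraction zero    {x} 0<x = x , 0<x , ≤-reflexive (+-identityʳ x)
  small-fraction (suc n) {x} 0<x with halve 0<x
  ... | h , 0<h , refl with small-fraction n 0<h
  -- One copy of the minimum fits into one half `h`, the other `suc n` copies fit into the second
  -- half.
  ... | y , 0<y , ny≤h = y ⊓ h , ⊓-elim (0# <_) 0<y 0<h ,
    (x⊓y≤y y h ⊹ ≤-trans (·-monoʳ-≤ (suc n) (x⊓y≤x y h)) ny≤h)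

-- Finite subsets: cardinalities and splitting along `m + k`.

p⊆q⇒p∩q≡p : ∀ {n} {p q : Subset n} → p ⊆ q → p ∩ q ≡ p
p⊆q⇒p∩q≡p p⊆q = ⊆-antisym (p∩q⊆p _ _) λ x∈p → x∈p∩q⁺ (x∈p , p⊆q x∈p)

∪-lub : ∀ {n} {p q r : Subset n} → p ⊆ r → q ⊆ r → p ∪ q ⊆ r
∪-lub {p = p} {q} p⊆r q⊆r x∈ with x∈p∪q⁻ p q x∈
... | inj₁ x∈p = p⊆r x∈p
... | inj₂ x∈q = q⊆r x∈q

p⊆q⇒p∪q≡q : ∀ {n} {p q : Subset n} → p ⊆ q → p ∪ q ≡ q
p⊆q⇒p∪q≡q {p = p} {q} p⊆q = ⊆-antisym (∪-lub p⊆q ⊆-refl) (q⊆p∪q p q)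

∣p∩q∣+∣p∪q∣≡∣p∣+∣q∣ : ∀ {n} (p q : Subset n) → ∣ p ∩ q ∣ ℕ.+ ∣ p ∪ q ∣ ≡ ∣ p ∣ ℕ.+ ∣ q ∣
∣p∩q∣+∣p∪q∣≡∣p∣+∣q∣ []          []          = refl
∣p∩q∣+∣p∪q∣≡∣p∣+∣q∣ (false ∷ p) (false ∷ q) = ∣p∩q∣+∣p∪q∣≡∣p∣+∣q∣ p q
∣p∩q∣+∣p∪q∣≡∣p∣+∣q∣ (true ∷ p)  (false ∷ q) =
  trans (ℕ.+-suc ∣ p ∩ q ∣ ∣ p ∪ q ∣) (cong suc (∣p∩q∣+∣p∪q∣≡∣p∣+∣q∣ p q))
∣p∩q∣+∣p∪q∣≡∣p∣+∣q∣ (false ∷ p) (true ∷ q)  =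
  trans (ℕ.+-suc ∣ p ∩ q ∣ ∣ p ∪ q ∣) (trans (cong suc (∣p∩q∣+∣p∪q∣≡∣p∣+∣q∣ p q)) (sym (ℕ.+-suc ∣ p ∣ ∣ q ∣)))
∣p∩q∣+∣p∪q∣≡∣p∣+∣q∣ (true ∷ p)  (true ∷ q)  = cong suc
  (trans (ℕ.+-suc ∣ p ∩ q ∣ ∣ p ∪ q ∣) (trans (cong suc (∣p∩q∣+∣p∪q∣≡∣p∣+∣q∣ p q)) (sym (ℕ.+-suc ∣ p ∣ ∣ q ∣))))

∣∁[p∩q]∣+∣∁[p∪q]∣≡∣∁p∣+∣∁q∣ : ∀ {n} (p q : Subset n) →
  ∣ ∁ (p ∩ q) ∣ ℕ.+ ∣ ∁ (p ∪ q) ∣ ≡ ∣ ∁ p ∣ ℕ.+ ∣ ∁ q ∣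
∣∁[p∩q]∣+∣∁[p∪q]∣≡∣∁p∣+∣∁q∣ {n} p q = begin
  ∣ ∁ (p ∩ q) ∣ ℕ.+ ∣ ∁ (p ∪ q) ∣ ≡⟨ cong₂ (λ r s → ∣ r ∣ ℕ.+ ∣ s ∣) (deMorgan₁ p q) (deMorgan₂ p q) ⟩
  ∣ ∁ p ∪ ∁ q ∣ ℕ.+ ∣ ∁ p ∩ ∁ q ∣ ≡⟨ ℕ.+-comm ∣ ∁ p ∪ ∁ q ∣ _ ⟩
  ∣ ∁ p ∩ ∁ q ∣ ℕ.+ ∣ ∁ p ∪ ∁ q ∣ ≡⟨ ∣p∩q∣+∣p∪q∣≡∣p∣+∣q∣ (∁ p) (∁ q) ⟩
  ∣ ∁ p ∣ ℕ.+ ∣ ∁ q ∣             ∎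
  where
  open ≡-Reasoning
  open BA (∪-∩-booleanAlgebra n) using (deMorgan₁; deMorgan₂)

∣p∣+∣∁p∣≡n : ∀ {n} (p : Subset n) → ∣ p ∣ ℕ.+ ∣ ∁ p ∣ ≡ n
∣p∣+∣∁p∣≡n p = trans (cong (∣ p ∣ ℕ.+_) (∣∁p∣≡n∸∣p∣ p)) (ℕ.m+[n∸m]≡n (∣p∣≤n p))

-- Inclusion becomes the equation `p ∩ q ≡ p`, which `take` preserves because it commutes with
-- pointwise operations.
take-mono-⊆ : ∀ m {k} {p q : Subset (m ℕ.+ k)} → p ⊆ q → take m p ⊆ take m q
take-mono-⊆ m {_} {p} {q} p⊆q = subst (_⊆ take m q)
  (trans (sym (take-zipWith _ p q)) (cong (take m) (p⊆q⇒p∩q≡p p⊆q)))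
  (p∩q⊆q (take m p) (take m q))

drop-mono-⊆ : ∀ m {k} {p q : Subset (m ℕ.+ k)} → p ⊆ q → drop m p ⊆ drop m q
drop-mono-⊆ m {_} {p} {q} p⊆q = subst (_⊆ drop m q)
  (trans (sym (drop-zipWith {m = m} _ p q)) (cong (drop m) (p⊆q⇒p∩q≡p p⊆q)))
  (p∩q⊆q (drop m p) (drop m q))

take-++ : ∀ {m k} (p : Subset m) (q : Subset k) → take m (p ++ q) ≡ p
take-++ []      q = refl
take-++ (x ∷ p) q = cong (x ∷_) (take-++ p q)

drop-++ : ∀ {m k} (p : Subset m) (q : Subset k) → drop m (p ++ q) ≡ q
drop-++ []      q = refl
drop-++ (x ∷ p) q = drop-++ p q

replicate-+ : ∀ m k → replicate (m ℕ.+ k) false ≡ replicate m false ++ replicate k false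
replicate-+ zero    k = refl
replicate-+ (suc m) k = cong (false ∷_) (replicate-+ m k)

inˡ : ∀ {n} {p q r : Subset n} → p ⊆ q → p ⊆ q ∪ r
inˡ {r = r} p⊆q x∈p = p⊆p∪q r (p⊆q x∈p)

inʳ : ∀ {n} {p q r : Subset n} → p ⊆ r → p ⊆ q ∪ r
inʳ {q = q} {r} p⊆r x∈p = q⊆p∪q q r (p⊆r x∈p)

⊆∩ : ∀ {n} {p q r : Subset n} → p ⊆ q → p ⊆ r → p ⊆ q ∩ r
⊆∩ p⊆q p⊆r x∈p = x∈p∩q⁺ (p⊆q x∈p , p⊆r x∈p)

missing : ∀ {n} → Subset n → ℕ
missing S = ∣ ∁ S ∣

missing-∪ : ∀ {n} (S T : Subset n) → missing (S ∪ T) ℕ.≤ missing S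
missing-∪ S T = p⊆q⇒∣p∣≤∣q∣ {p = ∁ (S ∪ T)} {∁ S} (p⊆q⇒∁p⊇∁q (p⊆p∪q T))

-- Extensions by a pool of interchangeable elements.

-- A set X ∪ S with X ⊆ M and S in a pool of interchangeable new elements gets
-- rank G c X + ∣ S ∣ · p, where c is the number of pool elements missing from S.

module Layers (ℝ : RealField) {m : ℕ} (G : ℕ → Subset m → RealField.Carrier ℝ) (p : RealField.Carrier ℝ) where
  open Reals ℝ
  open Poly ℝ

  -- The increment `G (suc c) X - G c X` is the part of `p` that an added pool element loses. By
  -- `quotient` the loss grows with `X`, by `concave` it grows as more elements are present, and
  -- `bounded` keeps it at most `p`, so that adding an element never lowers the rank.
  record IsLayered : Set where
    field
      mono     : ∀ c {X Y} → X ⊆ Y → G c X ≤ G c Y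
      submod   : ∀ c X Y → G c (X ∩ Y) + G c (X ∪ Y) ≤ G c X + G c Y
      quotient : ∀ c {X Y} → X ⊆ Y → G c Y + G (suc c) X ≤ G c X + G (suc c) Y
      concave  : ∀ c X → G (suc (suc c)) X + G c X ≤ G (suc c) X + G (suc c) X
      bounded  : ∀ c X → G (suc c) X ≤ G c X + p

  layer : ∀ {k} → Subset m → Subset k → Carrier
  layer X S = G (missing S) X + ∣ S ∣ · p

  rank : ∀ {k} → Subset (m ℕ.+ k) → Carrier
  rank V = layer (take m V) (drop m V)

  rank-++ : ∀ {k} (X : Subset m) (S : Subset k) → rank (X ++ S) ≡ layer X S
  rank-++ X S = cong₂ layer (take-++ X S) (drop-++ X S)

  module _ (layered : IsLayered) where
    open IsLayered layered

    -- At equal levels this is `quotient`; each further step of `c′` is one use of `concave`.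
    increment-antitone : ∀ {c c′ X Y} → X ⊆ Y → c ℕ.≤′ c′ → G (suc c′) X + G c Y ≤ G c′ X + G (suc c) Y
    increment-antitone {c} {_} {X} {Y} X⊆Y ℕ.≤′-refl =
      by (quotient c X⊆Y) (solve 4 (λ a b c d → (a ⊕ b) ⊕ (c ⊕ d) ⊜ (c ⊕ d) ⊕ (b ⊕ a)) refl
        (G (suc c) X) (G c Y) (G c X) (G (suc c) Y))
    increment-antitone {c} {suc c′} {X} {Y} X⊆Y (ℕ.≤′-step c≤c′) =
      by (concave c′ X ⊹ increment-antitone X⊆Y c≤c′)
        (solve 5 (λ a b c d e → (a ⊕ b) ⊕ ((d ⊕ d) ⊕ (c ⊕ e)) ⊜ (d ⊕ e) ⊕ ((a ⊕ c) ⊕ (d ⊕ b))) refl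
          (G (suc (suc c′)) X) (G c Y) (G c′ X) (G (suc c′) X) (G (suc c) Y))

    -- Telescopes `e` single increments.
    difference-antitone : ∀ e {c c′ X Y} → X ⊆ Y → c ℕ.≤ c′ →
                          G (e ℕ.+ c′) X + G c Y ≤ G c′ X + G (e ℕ.+ c) Y
    difference-antitone zero    _   _    = ≤-refl
    difference-antitone (suc e) {c} {c′} {X} {Y} X⊆Y c≤c′ =
      by (increment-antitone X⊆Y (ℕ.≤⇒≤′ (ℕ.+-monoʳ-≤ e c≤c′)) ⊹ difference-antitone e X⊆Y c≤c′)
        (solve 6 (λ a b c d x y → (a ⊕ b) ⊕ ((x ⊕ d) ⊕ (c ⊕ y)) ⊜ (c ⊕ d) ⊕ ((a ⊕ y) ⊕ (x ⊕ b))) refl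
          (G (suc e ℕ.+ c′) X) (G c Y) (G c′ X) (G (suc e ℕ.+ c) Y) (G (e ℕ.+ c′) X) (G (e ℕ.+ c) Y))

    -- Here `u` elements are missing from the union. The level of `X ∩ Y` is lowered by `e` while
    -- that of `X ∪ Y` rises by `e`, then lowered by `e′` along with that of `Y`; `submod` applies
    -- at the common level `e + u`.
    submod-layers : ∀ u e e′ X Y →
      G (e ℕ.+ (e′ ℕ.+ (e ℕ.+ u))) (X ∩ Y) + G u (X ∪ Y) ≤ G (e ℕ.+ u) X + G (e′ ℕ.+ (e ℕ.+ u)) Y
    submod-layers u e e′ X Y =
      by (difference-antitone e {u} {c₂} (λ x∈ → p⊆p∪q Y (p∩q⊆p X Y x∈)) (ℕ.≤-trans (ℕ.m≤n+m u e) (ℕ.m≤n+m c₁ e′))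
          ⊹ difference-antitone e′ {c₁} {c₁} (p∩q⊆q X Y) ℕ.≤-refl
          ⊹ submod c₁ X Y)
        (solve 8 (λ a b c d x y z w → (a ⊕ b) ⊕ ((x ⊕ y) ⊕ ((z ⊕ d) ⊕ (c ⊕ w))) ⊜
                                      (c ⊕ d) ⊕ ((a ⊕ b) ⊕ ((x ⊕ w) ⊕ (z ⊕ y)))) refl
          (G (e ℕ.+ c₂) (X ∩ Y)) (G u (X ∪ Y)) (G c₁ X) (G c₂ Y) (G c₂ (X ∩ Y)) (G c₁ (X ∪ Y)) (G c₁ (X ∩ Y)) (G c₁ Y))
      where
      c₁ = e ℕ.+ u
      c₂ = e′ ℕ.+ c₁

    submod-layers′ : ∀ {i u c₁ c₂} X Y → i ℕ.+ u ≡ c₁ ℕ.+ c₂ → u ℕ.≤ c₁ → c₁ ℕ.≤ c₂ →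
      G i (X ∩ Y) + G u (X ∪ Y) ≤ G c₁ X + G c₂ Y
    submod-layers′ {i} {u} {c₁} {c₂} X Y eq u≤c₁ c₁≤c₂
      with c₁ ℕ.∸ u | ℕ.m∸n+n≡m u≤c₁ | c₂ ℕ.∸ c₁ | ℕ.m∸n+n≡m c₁≤c₂
    ... | e | refl | e′ | refl = subst (λ i → G i (X ∩ Y) + G u (X ∪ Y) ≤ G (e ℕ.+ u) X + G (e′ ℕ.+ (e ℕ.+ u)) Y)
      (sym i≡) (submod-layers u e e′ X Y)
      where
      open ≡-Reasoning
      i≡ : i ≡ e ℕ.+ (e′ ℕ.+ (e ℕ.+ u))
      i≡ = ℕ.+-cancelʳ-≡ u i _ (begin
        i ℕ.+ u                            ≡⟨ eq ⟩
        (e ℕ.+ u) ℕ.+ (e′ ℕ.+ (e ℕ.+ u))   ≡⟨ ℕ.+-assoc e u _ ⟩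
        e ℕ.+ (u ℕ.+ (e′ ℕ.+ (e ℕ.+ u)))   ≡⟨ cong (e ℕ.+_) (ℕ.+-comm u _) ⟩
        e ℕ.+ ((e′ ℕ.+ (e ℕ.+ u)) ℕ.+ u)   ≡⟨ ℕ.+-assoc e _ u ⟨
        e ℕ.+ (e′ ℕ.+ (e ℕ.+ u)) ℕ.+ u     ∎)

    submod-pool : ∀ {k} X Y (S T : Subset k) →
      G (missing (S ∩ T)) (X ∩ Y) + G (missing (S ∪ T)) (X ∪ Y) ≤ G (missing S) X + G (missing T) Y
    submod-pool X Y S T with ℕ.≤-total (missing S) (missing T)
    ... | inj₁ S≤T = submod-layers′ X Y (∣∁[p∩q]∣+∣∁[p∪q]∣≡∣∁p∣+∣∁q∣ S T)
                       (missing-∪ S T) S≤T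
    ... | inj₂ T≤S = subst₂ _≤_
      (cong₂ _+_ (cong₂ (λ R → G (missing R)) (∩-comm T S) (∩-comm Y X)) (cong₂ (λ R → G (missing R)) (∪-comm T S) (∪-comm Y X)))
      (+-comm (G (missing T) Y) (G (missing S) X))
      (submod-layers′ Y X (∣∁[p∩q]∣+∣∁[p∪q]∣≡∣∁p∣+∣∁q∣ T S) (missing-∪ T S) T≤S)

    bounded-iter : ∀ d c X → G (d ℕ.+ c) X ≤ G c X + d · p
    bounded-iter zero    c X = ≤-reflexive (sym (+-identityʳ (G c X)))
    bounded-iter (suc d) c X = by (bounded (d ℕ.+ c) X ⊹ bounded-iter d c X)
      (solve 5 (λ a b x p y → a ⊕ ((x ⊕ p) ⊕ (b ⊕ y)) ⊜ (b ⊕ (p ⊕ y)) ⊕ (a ⊕ x)) refl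
        (G (suc d ℕ.+ c) X) (G c X) (G (d ℕ.+ c) X) p (d · p))

    mono-pool : ∀ {k} X {S T : Subset k} → S ⊆ T →
      layer X S ≤ layer X T
    mono-pool X {S} {T} S⊆T with ∣ T ∣ ℕ.∸ ∣ S ∣ in eq
    ... | d = by (bounded-iter d (missing T) X)
      (trans (cong (λ c → (G c X + ∣ S ∣ · p) + (G (missing T) X + d · p)) ∁S≡)
      (trans (solve 4 (λ a s b t → (a ⊕ s) ⊕ (b ⊕ t) ⊜ (b ⊕ (t ⊕ s)) ⊕ a) refl
         (G (d ℕ.+ missing T) X) (∣ S ∣ · p) (G (missing T) X) (d · p))
       (cong (λ z → (G (missing T) X + z) + G (d ℕ.+ missing T) X)
         (trans (sym (×-homo-+ p d ∣ S ∣)) (cong (_· p) d+S)))))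
      where
      d+S : d ℕ.+ ∣ S ∣ ≡ ∣ T ∣
      d+S = trans (cong (ℕ._+ ∣ S ∣) (sym eq)) (ℕ.m∸n+n≡m (p⊆q⇒∣p∣≤∣q∣ S⊆T))
      ∁S≡ : (missing S) ≡ d ℕ.+ (missing T)
      ∁S≡ = ℕ.+-cancelˡ-≡ ∣ S ∣ (missing S) (d ℕ.+ missing T) (begin
        ∣ S ∣ ℕ.+ (missing S)           ≡⟨ ∣p∣+∣∁p∣≡n S ⟩
        _                           ≡⟨ ∣p∣+∣∁p∣≡n T ⟨
        ∣ T ∣ ℕ.+ (missing T)           ≡⟨ cong (ℕ._+ (missing T)) (trans (sym d+S) (ℕ.+-comm d ∣ S ∣)) ⟩
        ∣ S ∣ ℕ.+ d ℕ.+ (missing T)     ≡⟨ ℕ.+-assoc ∣ S ∣ d (missing T) ⟩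
        ∣ S ∣ ℕ.+ (d ℕ.+ missing T)   ∎)
        where open ≡-Reasoning

    rank-mono : ∀ {k} (V W : Subset (m ℕ.+ k)) → V ⊆ W → rank V ≤ rank W
    rank-mono V W V⊆W = ≤-trans (+-monoˡ-≤ _ (mono _ (take-mono-⊆ m V⊆W))) (mono-pool (take m W) (drop-mono-⊆ m V⊆W))

    layer-submod : ∀ {k} X Y (S T : Subset k) → layer (X ∩ Y) (S ∩ T) + layer (X ∪ Y) (S ∪ T) ≤ layer X S + layer Y T
    layer-submod X Y S T =
      by (submod-pool X Y S T ⊹ ≤-reflexive sizes)
        (solve 8 (λ a b c d a′ b′ c′ d′ → ((a ⊕ a′) ⊕ (b ⊕ b′)) ⊕ ((c ⊕ d) ⊕ (c′ ⊕ d′)) ⊜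
                                          ((c ⊕ c′) ⊕ (d ⊕ d′)) ⊕ ((a ⊕ b) ⊕ (a′ ⊕ b′))) refl
          (G (missing (S ∩ T)) (X ∩ Y)) (G (missing (S ∪ T)) (X ∪ Y)) (G (missing S) X) (G (missing T) Y)
          (∣ S ∩ T ∣ · p) (∣ S ∪ T ∣ · p) (∣ S ∣ · p) (∣ T ∣ · p))
      where
      sizes : ∣ S ∩ T ∣ · p + ∣ S ∪ T ∣ · p ≡ ∣ S ∣ · p + ∣ T ∣ · p
      sizes = trans (sym (×-homo-+ p ∣ S ∩ T ∣ ∣ S ∪ T ∣))
                (trans (cong (_· p) (∣p∩q∣+∣p∪q∣≡∣p∣+∣q∣ S T)) (×-homo-+ p ∣ S ∣ ∣ T ∣))

    rank-submod : ∀ {k} (V W : Subset (m ℕ.+ k)) → rank (V ∩ W) + rank (V ∪ W) ≤ rank V + rank W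
    rank-submod V W = subst (_≤ rank V + rank W)
      (cong₂ _+_ (cong₂ layer (sym (take-zipWith _ V W)) (sym (drop-zipWith {m = m} _ V W)))
                 (cong₂ layer (sym (take-zipWith _ V W)) (sym (drop-zipWith {m = m} _ V W))))
      (layer-submod (take m V) (take m W) (drop m V) (drop m W))

    -- On subsets of `M` all `k` pool elements are missing, so level `k` has to be `f`.
    rank-extends : ∀ {f : Subset m → Carrier} → IsPolymatroid f → ∀ k → (∀ X → G k X ≡ f X) → IsExtension f k rank
    rank-extends {f} poly k G≡f = record
      { polymatroid = record
        { empty = rank-∅
        ; nonneg = λ V → subst (_≤ rank V) rank-∅ (rank-mono _ V (⊆-min V))
        ; monotone = rank-mono
        ; submodular = rank-submod }
      ; restricts = restricts }
      where
      restricts : ∀ X → rank (X ++ replicate k false) ≡ f X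
      restricts X = begin
        rank (X ++ ⊥)              ≡⟨ rank-++ X ⊥ ⟩
        G (missing (⊥ {k})) X + ∣ ⊥ {k} ∣ · p ≡⟨ cong₂ (λ c s → G c X + s · p)
                                        (trans (cong (ℕ._+ (missing (⊥ {k}))) (sym (∣⊥∣≡0 k))) (∣p∣+∣∁p∣≡n ⊥)) (∣⊥∣≡0 k) ⟩
        G k X + 0#                 ≡⟨ +-identityʳ (G k X) ⟩
        G k X                      ≡⟨ G≡f X ⟩
        f X                        ∎
        where open ≡-Reasoning
      rank-∅ : rank (replicate (m ℕ.+ k) false) ≡ 0#
      rank-∅ = trans (cong rank (replicate-+ m k)) (trans (restricts ⊥) (IsPolymatroid.empty poly))

-- Submodular functions, quotients and contractions.

module Submodular (ℝ : RealField) {m : ℕ} where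
  open Reals ℝ

  record IsSubmodular (h : Subset m → Carrier) : Set where
    field
      mono   : ∀ {X Y} → X ⊆ Y → h X ≤ h Y
      submod : ∀ X Y → h (X ∩ Y) + h (X ∪ Y) ≤ h X + h Y

    submod-⊆ : ∀ {X Y Z W} → Z ⊆ X → Z ⊆ Y → W ⊆ X ∪ Y → h Z + h W ≤ h X + h Y
    submod-⊆ Z⊆X Z⊆Y W⊆X∪Y = ≤-trans (mono (⊆∩ Z⊆X Z⊆Y) ⊹ mono W⊆X∪Y) (submod _ _)

  -- The difference `k - h` is monotone; for matroid rank functions, `h` is a quotient of `k`.
  infix 4 _◁_
  _◁_ : (h k : Subset m → Carrier) → Set
  h ◁ k = ∀ {X Y} → X ⊆ Y → h Y + k X ≤ h X + k Y

  ◁-refl : ∀ {h} → h ◁ h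
  ◁-refl {h} {X} {Y} _ = ≤-reflexive (+-comm (h Y) (h X))

  ◁-trans : ∀ {h k l} → h ◁ k → k ◁ l → h ◁ l
  ◁-trans {h} {k} {l} h◁k k◁l {X} {Y} X⊆Y = by (h◁k X⊆Y ⊹ k◁l X⊆Y)
    (solve 6 (λ hx hy kx ky lx ly → (hy ⊕ lx) ⊕ ((hx ⊕ ky) ⊕ (kx ⊕ ly)) ⊜ (hx ⊕ ly) ⊕ ((hy ⊕ kx) ⊕ (ky ⊕ lx))) refl
      (h X) (h Y) (k X) (k Y) (l X) (l Y))

  -- Contraction of an element of rank -ν placed freely on F.
  contract : Carrier → Subset m → (Subset m → Carrier) → Subset m → Carrier
  contract ν F h X = h X ⊓ (h (X ∪ F) + ν)

  contractAll : Carrier → List (Subset m) → (Subset m → Carrier) → Subset m → Carrier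
  contractAll ν Fs h = foldr (contract ν) h Fs

  module _ {h : Subset m → Carrier} (sub : IsSubmodular h) (ν : Carrier) (F : Subset m) where
    open IsSubmodular sub

    -- There are four cases for the terms attaining the two minima on the right. On the left, `F` is
    -- joined to the union if it occurs in either term, and to the intersection only if it occurs in
    -- both.
    contract-submodular : IsSubmodular (contract ν F h)
    contract-submodular = record { mono = mono′ ; submod = submod′ }
      where
      mono′ : ∀ {X Y} → X ⊆ Y → contract ν F h X ≤ contract ν F h Y
      mono′ X⊆Y = ⊓-mono-≤ (mono X⊆Y) (+-monoˡ-≤ ν (mono (∪-lub (inˡ X⊆Y) (inʳ ⊆-refl))))
      submod′ : ∀ X Y → contract ν F h (X ∩ Y) + contract ν F h (X ∪ Y) ≤ contract ν F h X + contract ν F h Y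
      submod′ X Y =
        ⊓-elim (λ z → c∩ + c∪ ≤ z + contract ν F h Y)
          (⊓-elim (λ z → c∩ + c∪ ≤ h X + z)
            (≤-trans (x⊓y≤x _ _ ⊹ x⊓y≤x _ _) (submod X Y))
            (by (x⊓y≤x _ _ ⊹ x⊓y≤y _ _ ⊹ submod-⊆ {X} {Y ∪ F} (p∩q⊆p X Y) (inˡ (p∩q⊆q X Y))
                  (∪-lub (∪-lub (inˡ ⊆-refl) (inʳ (inˡ ⊆-refl))) (inʳ (inʳ ⊆-refl))))
              (solve 7 (λ c d a b x y ν → (c ⊕ d) ⊕ (a ⊕ ((b ⊕ ν) ⊕ (x ⊕ y))) ⊜
                                          (x ⊕ (y ⊕ ν)) ⊕ (c ⊕ (d ⊕ (a ⊕ b)))) refl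
                c∩ c∪ (h (X ∩ Y)) (h ((X ∪ Y) ∪ F)) (h X) (h (Y ∪ F)) ν)))
          (⊓-elim (λ z → c∩ + c∪ ≤ (h (X ∪ F) + ν) + z)
            (by (x⊓y≤x _ _ ⊹ x⊓y≤y _ _ ⊹ submod-⊆ {X ∪ F} {Y} (inˡ (p∩q⊆p X Y)) (p∩q⊆q X Y)
                  (∪-lub (∪-lub (inˡ (inˡ ⊆-refl)) (inʳ ⊆-refl)) (inˡ (inʳ ⊆-refl))))
              (solve 7 (λ c d a b x y ν → (c ⊕ d) ⊕ (a ⊕ ((b ⊕ ν) ⊕ (x ⊕ y))) ⊜
                                          ((x ⊕ ν) ⊕ y) ⊕ (c ⊕ (d ⊕ (a ⊕ b)))) refl
                c∩ c∪ (h (X ∩ Y)) (h ((X ∪ Y) ∪ F)) (h (X ∪ F)) (h Y) ν))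
            (by (x⊓y≤y _ _ ⊹ x⊓y≤y _ _ ⊹ submod-⊆ {X ∪ F} {Y ∪ F} {(X ∩ Y) ∪ F} {(X ∪ Y) ∪ F}
                  (∪-lub (inˡ (p∩q⊆p X Y)) (inʳ ⊆-refl))
                  (∪-lub (inˡ (p∩q⊆q X Y)) (inʳ ⊆-refl))
                  (∪-lub (∪-lub (inˡ (inˡ ⊆-refl)) (inʳ (inˡ ⊆-refl))) (inˡ (inʳ ⊆-refl))))
              (solve 7 (λ c d a b x y ν → (c ⊕ d) ⊕ ((a ⊕ ν) ⊕ ((b ⊕ ν) ⊕ (x ⊕ y))) ⊜
                                          ((x ⊕ ν) ⊕ (y ⊕ ν)) ⊕ (c ⊕ (d ⊕ (a ⊕ b)))) refl
                c∩ c∪ (h ((X ∩ Y) ∪ F)) (h ((X ∪ Y) ∪ F)) (h (X ∪ F)) (h (Y ∪ F)) ν)))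
        where
        c∩ = contract ν F h (X ∩ Y)
        c∪ = contract ν F h (X ∪ Y)

    -- The loss `h X - contract ν F h X` is the positive part of `- ν` minus the marginal rank of
    -- `F` over `X`, and submodularity makes that marginal rank shrink as `X` grows.
    contract-◁ : contract ν F h ◁ h
    contract-◁ {X} {Y} X⊆Y = ⊓-elim (λ z → contract ν F h Y + h X ≤ z + h Y)
      (by (x⊓y≤x (h Y) _) (solve 3 (λ c x y → (c ⊕ x) ⊕ y ⊜ (x ⊕ y) ⊕ c) refl (contract ν F h Y) (h X) (h Y)))
      (by (x⊓y≤y _ (h (Y ∪ F) + ν) ⊹ submod-⊆ {X ∪ F} {Y} {X} {Y ∪ F} (inˡ ⊆-refl) X⊆Y (∪-lub (inʳ ⊆-refl) (inˡ (inʳ ⊆-refl))))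
        (solve 6 (λ c x y yF xF ν → (c ⊕ x) ⊕ ((yF ⊕ ν) ⊕ (xF ⊕ y)) ⊜ ((xF ⊕ ν) ⊕ y) ⊕ (c ⊕ (x ⊕ yF))) refl
          (contract ν F h Y) (h X) (h Y) (h (Y ∪ F)) (h (X ∪ F)) ν))

  module _ {h : Subset m → Carrier} (sub : IsSubmodular h) (ν : Carrier) where
    contractAll-submodular : ∀ Fs → IsSubmodular (contractAll ν Fs h)
    contractAll-submodular []       = sub
    contractAll-submodular (F ∷ Fs) = contract-submodular (contractAll-submodular Fs) ν F

    contractAll-◁ : ∀ Fs → contractAll ν Fs h ◁ h
    contractAll-◁ []       = ◁-refl
    contractAll-◁ (F ∷ Fs) = ◁-trans (contract-◁ (contractAll-submodular Fs) ν F) (contractAll-◁ Fs)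

    contractAll-≤ : ∀ Fs X → contractAll ν Fs h X ≤ h X
    contractAll-≤ []       X = ≤-refl
    contractAll-≤ (F ∷ Fs) X = ≤-trans (x⊓y≤x _ _) (contractAll-≤ Fs X)

    contractAll-≤-∈ : ∀ {Fs F} → F ∈ Fs → ∀ X → contractAll ν Fs h X ≤ h (X ∪ F) + ν
    contractAll-≤-∈ {F ∷ Fs} (here refl) X = ≤-trans (x⊓y≤y _ _) (+-monoˡ-≤ ν (contractAll-≤ Fs (X ∪ F)))
    contractAll-≤-∈ {F ∷ Fs} (there F∈) X = ≤-trans (x⊓y≤x _ _) (contractAll-≤-∈ F∈ X)

    -- By monotonicity a single contraction costs at most `η`. The total is what `bounded` has to
    -- absorb at the last pool element.
    ≤-contractAll : ∀ {η} → 0# ≤ η → η + ν ≡ 0# → ∀ Fs X → h X ≤ contractAll ν Fs h X + length Fs · η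
    ≤-contractAll         0≤η η+ν≡0 []       X = ≤-reflexive (sym (+-identityʳ (h X)))
    ≤-contractAll {η} 0≤η η+ν≡0 (F ∷ Fs) X = ⊓-elim (λ z → h X ≤ z + (η + length Fs · η))
      (by (≤-contractAll 0≤η η+ν≡0 Fs X ⊹ 0≤η)
        (solve 4 (λ x c l η → x ⊕ ((c ⊕ l) ⊕ η) ⊜ (c ⊕ (η ⊕ l)) ⊕ (x ⊕ id)) refl (h X) (contractAll ν Fs h X) (length Fs · η) η))
      (by (≤-contractAll 0≤η η+ν≡0 Fs (X ∪ F) ⊹ IsSubmodular.mono sub (p⊆p∪q F) ⊹ ≤-reflexive (sym η+ν≡0))
        (solve 6 (λ x xF c l η ν → x ⊕ ((c ⊕ l) ⊕ (xF ⊕ (η ⊕ ν))) ⊜ ((c ⊕ ν) ⊕ (η ⊕ l)) ⊕ (xF ⊕ (x ⊕ id))) refl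
          (h X) (h (X ∪ F)) (contractAll ν Fs h (X ∪ F)) (length Fs · η) η ν))

-- Flats of equal rank above a given set.

module Closure (ℝ : RealField) {m : ℕ} {f : Subset m → RealField.Carrier ℝ} (poly : Poly.IsPolymatroid ℝ f) where
  open Reals ℝ
  open Poly ℝ
  open Submodular ℝ {m}
  open IsPolymatroid poly using (monotone; submodular)

  submodular′ : IsSubmodular f
  submodular′ = record { mono = λ {X} {Y} → monotone X Y ; submod = submodular }

  private
    -- While some proper superset has no larger rank, pass to it; in a finite set this ends, and it
    -- ends at a flat.
    closure-acc : ∀ X → Acc (λ Y Z → Z ⊂ Y) X → ∃ λ F → IsFlat f F × X ⊆ F × f F ≡ f X
    closure-acc X (acc rec) with anySubset? (λ Y → (X ⊂? Y) ×-dec (f Y ≤? f X))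
    ... | no flat = X , (λ Y X⊂Y → ≰⇒> λ fY≤fX → flat (Y , X⊂Y , fY≤fX)) , ⊆-refl , refl
    ... | yes (Y , X⊂Y , fY≤fX) with closure-acc Y (rec X⊂Y)
    ... | F , flat , Y⊆F , fF≡fY =
      F , flat , ⊆-trans (p⊂q⇒p⊆q X⊂Y) Y⊆F ,
      trans fF≡fY (≤-antisym fY≤fX (monotone X Y (p⊂q⇒p⊆q X⊂Y)))

  closure : ∀ X → ∃ λ F → IsFlat f F × X ⊆ F × f F ≡ f X
  closure X = closure-acc X (⊃-wellFounded X)

-- The least rank `f̂` of a member of the cut above a set.

module Cut
  (ℝ : RealField) {m : ℕ} {f : Subset m → RealField.Carrier ℝ} (poly : Poly.IsPolymatroid ℝ f)
  {𝓜 : Subset m → Set} (cut : Poly.IsModularCut ℝ f 𝓜) (𝓜? : ∀ F → Dec (𝓜 F)) (𝓜⊤ : 𝓜 ⊤)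
  (Fs : List (Subset m)) (sound : ∀ {F} → F ∈ Fs → 𝓜 F) (complete : ∀ {F} → 𝓜 F → F ∈ Fs)
  where
  open Reals ℝ
  open Poly ℝ
  open Submodular ℝ {m}
  open Closure ℝ poly
  open IsModularCut cut
  open IsSubmodular submodular′

  private
    -- The default `f ⊤` is the value of the member `⊤`. Using `f (X ∪ F)` admits every member `F`,
    -- not only those above `X`.
    minOver : List (Subset m) → Subset m → Carrier
    minOver Gs X = foldr (λ F r → f (X ∪ F) ⊓ r) (f ⊤) Gs

    minOver-≤ : ∀ {Gs F} → F ∈ Gs → ∀ X → minOver Gs X ≤ f (X ∪ F)
    minOver-≤ (here refl) X = x⊓y≤x _ _
    minOver-≤ (there F∈)  X = ≤-trans (x⊓y≤y _ _) (minOver-≤ F∈ X)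

    minOver-attained : ∀ Gs → (∀ {F} → F ∈ Gs → 𝓜 F) → ∀ X → ∃ λ F → 𝓜 F × minOver Gs X ≡ f (X ∪ F)
    minOver-attained []       _   X = ⊤ , 𝓜⊤ , cong f (sym (∪-zeroʳ X))
    minOver-attained (G ∷ Gs) all X with ⊓-sel (f (X ∪ G)) (minOver Gs X)
    ... | inj₁ eq = G , all (here refl) , eq
    ... | inj₂ eq with minOver-attained Gs (λ F∈ → all (there F∈)) X
    ... | F , 𝓜F , eq′ = F , 𝓜F , trans eq eq′

  f̂ : Subset m → Carrier
  f̂ = minOver Fs

  f̂-≤ : ∀ {F} → 𝓜 F → ∀ X → f̂ X ≤ f (X ∪ F)
  f̂-≤ 𝓜F = minOver-≤ (complete 𝓜F)

  f̂-≤-⊆ : ∀ {F X} → 𝓜 F → X ⊆ F → f̂ X ≤ f F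
  f̂-≤-⊆ {F} {X} 𝓜F X⊆F = ≤-trans (f̂-≤ 𝓜F X) (mono (∪-lub X⊆F ⊆-refl))

  -- A flat above `X ∪ F` of the same rank belongs to `𝓜` by upward closure, and it contains `X`.
  f̂-attained : ∀ X → ∃ λ F → 𝓜 F × X ⊆ F × f̂ X ≡ f F
  f̂-attained X with minOver-attained Fs sound X
  ... | F , 𝓜F , eq with closure (X ∪ F)
  ... | F′ , flat , XF⊆F′ , eq′ =
    F′ , up-close F F′ 𝓜F (⊆-trans (q⊆p∪q X F) XF⊆F′) flat , ⊆-trans (p⊆p∪q F) XF⊆F′ , trans eq (sym eq′)

  f≤f̂ : ∀ X → f X ≤ f̂ X
  f≤f̂ X with f̂-attained X
  ... | F , _ , X⊆F , eq = subst (f X ≤_) (sym eq) (mono X⊆F)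

  f̂-mono : ∀ {X Y} → X ⊆ Y → f̂ X ≤ f̂ Y
  f̂-mono {X} X⊆Y with f̂-attained _
  ... | F , 𝓜F , Y⊆F , eq = subst (f̂ X ≤_) (sym eq) (f̂-≤-⊆ 𝓜F (⊆-trans X⊆Y Y⊆F))

  -- Submodularity of `f` for `X` and a member `G` above `Y` that attains `f̂ Y`.
  f+f̂-submod : ∀ X Y → f (X ∩ Y) + f̂ (X ∪ Y) ≤ f X + f̂ Y
  f+f̂-submod X Y with f̂-attained Y
  ... | G , 𝓜G , Y⊆G , eq rewrite eq =
    ≤-trans (+-monoʳ-≤ _ (≤-trans (f̂-≤ 𝓜G (X ∪ Y)) (mono (∪-lub (∪-lub (inˡ ⊆-refl) (inʳ Y⊆G)) (inʳ ⊆-refl)))))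
      (submod-⊆ {X} {G} (p∩q⊆p X Y) (⊆-trans (p∩q⊆q X Y) Y⊆G) ⊆-refl)

  -- This is `f+f̂-submod` for `Y` and `X`. Consequently, the sets on which a truncation falls below
  -- `f` are closed upwards.
  gap-antitone : ∀ {X Y} → X ⊆ Y → f X + f̂ Y ≤ f Y + f̂ X
  gap-antitone {X} {Y} X⊆Y = subst (_≤ f Y + f̂ X)
    (cong₂ (λ Z W → f Z + f̂ W) (trans (∩-comm Y X) (p⊆q⇒p∩q≡p X⊆Y)) (trans (∪-comm Y X) (p⊆q⇒p∪q≡q X⊆Y)))
    (f+f̂-submod Y X)

  -- Truncations of `f` along the modular cut.

  module Truncation (t : Carrier) (0<t : 0# < t)
    (defect : ∀ {F G} → 𝓜 F → 𝓜 G → ¬ 𝓜 (F ∩ G) → t + (f (F ∩ G) + f (F ∪ G)) ≤ f F + f G) where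

    -- For `s ≤ 0`, `trunc s X - s` is the smaller of `f X - s` and `f̂ X`: the rank of `X` together
    -- with a point of rank at most `- s` that lies in the closure of every member of `𝓜`.
    trunc : Carrier → Subset m → Carrier
    trunc s X = f X ⊓ (f̂ X + s)

    module _ {s : Carrier} (0≤t+s : 0# ≤ t + s) where
      private
        both : ∀ X Y → trunc s (X ∩ Y) + trunc s (X ∪ Y) ≤ (f̂ X + s) + (f̂ Y + s)
        both X Y with f̂-attained X | f̂-attained Y
        ... | F , 𝓜F , X⊆F , eqF | G , 𝓜G , Y⊆G , eqG rewrite eqF | eqG with 𝓜? (F ∩ G)
        -- The member `F ∩ G` bounds `f̂ (X ∩ Y)`, so both terms on the left may carry `s`.
        ... | yes 𝓜F∩G =
          by (x⊓y≤y _ _ ⊹ x⊓y≤y _ _ ⊹ f̂-≤-⊆ 𝓜F∩G (⊆∩ (⊆-trans (p∩q⊆p X Y) X⊆F) (⊆-trans (p∩q⊆q X Y) Y⊆G))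
               ⊹ ≤-trans (f̂-≤ 𝓜G (X ∪ Y)) (mono (∪-lub (∪-lub (inˡ X⊆F) (inʳ Y⊆G)) (inʳ ⊆-refl)))
               ⊹ submod F G)
            (solve 9 (λ c d a b p q x y s → (c ⊕ d) ⊕ ((a ⊕ s) ⊕ ((b ⊕ s) ⊕ (p ⊕ (q ⊕ (x ⊕ y))))) ⊜
                                          ((x ⊕ s) ⊕ (y ⊕ s)) ⊕ (c ⊕ (d ⊕ (a ⊕ (b ⊕ (p ⊕ q)))))) refl
              (trunc s (X ∩ Y)) (trunc s (X ∪ Y)) (f̂ (X ∩ Y)) (f̂ (X ∪ Y)) (f (F ∩ G)) (f (F ∪ G)) (f F) (f G) s)
        -- Only the union carries `s` now; the second `s` is paid for by the defect, which is at
        -- least `t ≥ - s`.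
        ... | no ¬𝓜F∩G =
          by (x⊓y≤x _ _ ⊹ x⊓y≤y _ _ ⊹ mono (⊆∩ (⊆-trans (p∩q⊆p X Y) X⊆F) (⊆-trans (p∩q⊆q X Y) Y⊆G))
               ⊹ ≤-trans (f̂-≤ 𝓜G (X ∪ Y)) (mono (∪-lub (∪-lub (inˡ X⊆F) (inʳ Y⊆G)) (inʳ ⊆-refl)))
               ⊹ defect 𝓜F 𝓜G ¬𝓜F∩G ⊹ 0≤t+s)
            (solve 10 (λ c d a b p q x y s t → (c ⊕ d) ⊕ (a ⊕ ((b ⊕ s) ⊕ (p ⊕ (q ⊕ ((x ⊕ y) ⊕ (t ⊕ s)))))) ⊜
                                          ((x ⊕ s) ⊕ (y ⊕ s)) ⊕ (c ⊕ (d ⊕ (a ⊕ (b ⊕ ((t ⊕ (p ⊕ q)) ⊕ id)))))) refl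
              (trunc s (X ∩ Y)) (trunc s (X ∪ Y)) (f (X ∩ Y)) (f̂ (X ∪ Y)) (f (F ∩ G)) (f (F ∪ G)) (f F) (f G) s t)

        mixed : ∀ X Y → trunc s (X ∩ Y) + trunc s (X ∪ Y) ≤ f X + (f̂ Y + s)
        mixed X Y = by (x⊓y≤x _ _ ⊹ x⊓y≤y _ _ ⊹ f+f̂-submod X Y)
          (solve 7 (λ c d a b x y s → (c ⊕ d) ⊕ (a ⊕ ((b ⊕ s) ⊕ (x ⊕ y))) ⊜ (x ⊕ (y ⊕ s)) ⊕ (c ⊕ (d ⊕ (a ⊕ b)))) refl
            (trunc s (X ∩ Y)) (trunc s (X ∪ Y)) (f (X ∩ Y)) (f̂ (X ∪ Y)) (f X) (f̂ Y) s)

      trunc-submodular : IsSubmodular (trunc s)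
      trunc-submodular = record
        { mono   = λ X⊆Y → ⊓-mono-≤ (mono X⊆Y) (+-monoˡ-≤ s (f̂-mono X⊆Y))
        ; submod = λ X Y → ⊓-elim (λ z → trunc s (X ∩ Y) + trunc s (X ∪ Y) ≤ z + trunc s Y)
            (⊓-elim (λ z → trunc s (X ∩ Y) + trunc s (X ∪ Y) ≤ f X + z)
              (≤-trans (x⊓y≤x _ _ ⊹ x⊓y≤x _ _) (submod X Y))
              (mixed X Y))
            (⊓-elim (λ z → trunc s (X ∩ Y) + trunc s (X ∪ Y) ≤ (f̂ X + s) + z)
              (subst₂ _≤_ (cong₂ (λ Z W → trunc s Z + trunc s W) (∩-comm Y X) (∪-comm Y X)) (+-comm (f Y) _) (mixed Y X))
              (both X Y)) }

    -- With d for `f̂ - f`, the difference of the truncations is min(0, d + s′) - min(0, d + s). It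
    -- decreases in d, and d decreases as the set grows.
    trunc-◁ : ∀ {s s′} → s ≤ s′ → trunc s ◁ trunc s′
    trunc-◁ {s} {s′} s≤s′ {X} {Y} X⊆Y = ⊓-elim (λ z → trunc s Y + trunc s′ X ≤ z + trunc s′ Y)
      (⊓-elim (λ z → trunc s Y + trunc s′ X ≤ f X + z)
        (subst (trunc s Y + trunc s′ X ≤_) (+-comm (f Y) (f X)) (x⊓y≤x _ _ ⊹ x⊓y≤x _ _))
        (subst (trunc s Y + trunc s′ X ≤_) (+-comm (f̂ Y + s′) (f X)) (≤-trans (x⊓y≤y _ _) (+-monoʳ-≤ (f̂ Y) s≤s′) ⊹ x⊓y≤x _ _)))
      (⊓-elim (λ z → trunc s Y + trunc s′ X ≤ (f̂ X + s) + z)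
        (by (x⊓y≤y _ _ ⊹ x⊓y≤x _ _ ⊹ gap-antitone X⊆Y)
          (solve 7 (λ a b fx fy gx gy s → (a ⊕ b) ⊕ ((gy ⊕ s) ⊕ (fx ⊕ (fy ⊕ gx))) ⊜ ((gx ⊕ s) ⊕ fy) ⊕ (a ⊕ (b ⊕ (fx ⊕ gy)))) refl
            (trunc s Y) (trunc s′ X) (f X) (f Y) (f̂ X) (f̂ Y) s))
        (by (x⊓y≤y _ _ ⊹ x⊓y≤y _ _)
          (solve 6 (λ a b gx gy s s′ → (a ⊕ b) ⊕ ((gy ⊕ s) ⊕ (gx ⊕ s′)) ⊜ ((gx ⊕ s) ⊕ (gy ⊕ s′)) ⊕ (a ⊕ b)) refl
            (trunc s Y) (trunc s′ X) (f̂ X) (f̂ Y) s s′)))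

    -- A minimum of a constant and an affine function of `s` is concave in `s`.
    trunc-concave : ∀ {s₀ s₁ s₂} → s₂ + s₀ ≡ s₁ + s₁ → ∀ X → trunc s₂ X + trunc s₀ X ≤ trunc s₁ X + trunc s₁ X
    trunc-concave {s₀} {s₁} {s₂} eq X = ⊓-elim (λ z → trunc s₂ X + trunc s₀ X ≤ z + z)
      (x⊓y≤x _ _ ⊹ x⊓y≤x _ _)
      (by (x⊓y≤y _ _ ⊹ x⊓y≤y _ _ ⊹ ≤-reflexive eq)
        (solve 6 (λ a b g s₀ s₁ s₂ → (a ⊕ b) ⊕ ((g ⊕ s₂) ⊕ ((g ⊕ s₀) ⊕ (s₁ ⊕ s₁))) ⊜
                                     ((g ⊕ s₁) ⊕ (g ⊕ s₁)) ⊕ (a ⊕ (b ⊕ (s₂ ⊕ s₀)))) refl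
          (trunc s₂ X) (trunc s₀ X) (f̂ X) s₀ s₁ s₂))

    trunc-bounded : ∀ {s s′ p} → 0# ≤ p → s′ ≤ s + p → ∀ X → trunc s′ X ≤ trunc s X + p
    trunc-bounded {s} {s′} {p} 0≤p s′≤s+p X = ⊓-elim (λ z → trunc s′ X ≤ z + p)
      (by (x⊓y≤x _ _ ⊹ 0≤p) (solve 3 (λ a x p → a ⊕ (x ⊕ p) ⊜ (x ⊕ p) ⊕ (a ⊕ id)) refl (trunc s′ X) (f X) p))
      (by (x⊓y≤y _ _ ⊹ s′≤s+p)
        (solve 5 (λ a g s s′ p → a ⊕ ((g ⊕ s′) ⊕ (s ⊕ p)) ⊜ ((g ⊕ s) ⊕ p) ⊕ (a ⊕ s′)) refl (trunc s′ X) (f̂ X) s s′ p))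

    trunc-full : ∀ {s} → 0# ≤ s → ∀ X → trunc s X ≡ f X
    trunc-full {s} 0≤s X = ≤-antisym (x⊓y≤x _ _)
      (⊓-glb ≤-refl (subst (_≤ f̂ X + s) (+-identityʳ (f X)) (f≤f̂ X ⊹ 0≤s)))

    -- Starts at `- t`, the lowest value for which submodularity is shown; each missing element
    -- gives back `η`, until the truncation is `f` once `c · η ≥ t`.
    level : Carrier → ℕ → Carrier
    level η c = c · η + - t

    0≤t+level : ∀ {η} → 0# ≤ η → ∀ c → 0# ≤ t + level η c
    0≤t+level {η} 0≤η c = by (·-nonneg c 0≤η ⊹ ≤-reflexive (sym (-‿inverseʳ t)))
      (solve 3 (λ cη t t⁻ → id ⊕ (cη ⊕ (t ⊕ t⁻)) ⊜ (t ⊕ (cη ⊕ t⁻)) ⊕ (id ⊕ id)) refl (c · η) t (- t))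

    level-suc : ∀ {η p} → η ≤ p → ∀ c → level η (suc c) ≤ level η c + p
    level-suc {η} {p} η≤p c = by η≤p
      (solve 4 (λ η p cη t⁻ → ((η ⊕ cη) ⊕ t⁻) ⊕ p ⊜ ((cη ⊕ t⁻) ⊕ p) ⊕ η) refl η p (c · η) (- t))

    level-concave : ∀ η c → level η (suc (suc c)) + level η c ≡ level η (suc c) + level η (suc c)
    level-concave η c = solve 3 (λ η cη t⁻ → ((η ⊕ (η ⊕ cη)) ⊕ t⁻) ⊕ (cη ⊕ t⁻) ⊜ ((η ⊕ cη) ⊕ t⁻) ⊕ ((η ⊕ cη) ⊕ t⁻)) refl
      η (c · η) (- t)

    level-≤-suc : ∀ {η} → 0# ≤ η → ∀ c → level η c ≤ level η (suc c)
    level-≤-suc {η} 0≤η c = by 0≤η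
      (solve 3 (λ η cη t⁻ → (cη ⊕ t⁻) ⊕ η ⊜ ((η ⊕ cη) ⊕ t⁻) ⊕ id) refl η (c · η) (- t))

    -- Layers built from truncations.

    module TruncLayers {η p : Carrier} (0≤η : 0# ≤ η) (η≤p : η ≤ p) where
      open Layers ℝ (λ c → trunc (level η c)) p public

      layered : IsLayered
      layered = record
        { mono     = λ c → IsSubmodular.mono (trunc-submodular (0≤t+level 0≤η c))
        ; submod   = λ c → IsSubmodular.submod (trunc-submodular (0≤t+level 0≤η c))
        ; quotient = λ c → trunc-◁ (level-≤-suc 0≤η c)
        ; concave  = λ c → trunc-concave (level-concave η c)
        ; bounded  = λ c → trunc-bounded (≤-trans 0≤η η≤p) (level-suc η≤p c)
        }

    module PoolLayers {η p : Carrier} (0≤η : 0# ≤ η) (η≤p : η ≤ p) (∣Fs∣η≤p : length Fs · η ≤ p) where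
      private module T = TruncLayers 0≤η η≤p

      top : Subset m → Carrier
      top = contractAll (- η) Fs (trunc (level η 0))

      sub₀ : IsSubmodular (trunc (level η 0))
      sub₀ = trunc-submodular (0≤t+level 0≤η 0)

      -- Shifted by one: the lowest level `- t` belongs to one missing element, which leaves `top`
      -- for the complete pool.
      pool : ℕ → Subset m → Carrier
      pool zero    = top
      pool (suc c) = trunc (level η c)

      open Layers ℝ pool p public
      open T.IsLayered T.layered

      -- Where trunc (level η 0) differs from f, i.e. f̂ X - f X < t, the contraction
      -- belonging to the F ⊇ X with f F = f̂ X costs a full η.
      top-concave : ∀ X → trunc (level η 1) X + top X ≤ trunc (level η 0) X + trunc (level η 0) X
      top-concave X = ⊓-elim (λ z → trunc (level η 1) X + top X ≤ z + trunc (level η 0) X)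
        (x⊓y≤x _ _ ⊹ contractAll-≤ sub₀ (- η) Fs X)
        (≤-trans (+-monoʳ-≤ _ top≤) (⊓-elim (λ z → trunc (level η 1) X + ((f̂ X + level η 0) + - η) ≤ (f̂ X + level η 0) + z)
          (by (x⊓y≤x _ _ ⊹ 0≤η ⊹ ≤-reflexive (-‿inverseʳ η))
            (solve 6 (λ a g l η η⁻ x → (a ⊕ ((g ⊕ l) ⊕ η⁻)) ⊕ (x ⊕ (η ⊕ id)) ⊜ ((g ⊕ l) ⊕ x) ⊕ (a ⊕ (id ⊕ (η ⊕ η⁻)))) refl
              (trunc (level η 1) X) (f̂ X) (level η 0) η (- η) (f X)))
          (by (x⊓y≤y _ _ ⊹ level-suc ≤-refl 0 ⊹ ≤-reflexive (-‿inverseʳ η))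
            (solve 6 (λ a g l l′ η η⁻ → (a ⊕ ((g ⊕ l) ⊕ η⁻)) ⊕ ((g ⊕ l′) ⊕ ((l ⊕ η) ⊕ id)) ⊜
                                        ((g ⊕ l) ⊕ (g ⊕ l)) ⊕ (a ⊕ (l′ ⊕ (η ⊕ η⁻)))) refl
              (trunc (level η 1) X) (f̂ X) (level η 0) (level η 1) η (- η)))))
        where
        top≤ : top X ≤ (f̂ X + level η 0) + - η
        top≤ with f̂-attained X
        ... | F , 𝓜F , X⊆F , eq = ≤-trans (contractAll-≤-∈ sub₀ (- η) (complete 𝓜F) X)
          (+-monoˡ-≤ (- η) (≤-trans (x⊓y≤y _ _) (+-monoˡ-≤ (level η 0)
            (subst (f̂ (X ∪ F) ≤_) (sym eq) (f̂-≤-⊆ 𝓜F (∪-lub X⊆F ⊆-refl))))))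

      layered : IsLayered
      layered = record
        { mono = λ where
            zero    → IsSubmodular.mono (contractAll-submodular sub₀ (- η) Fs)
            (suc c) → mono′ c
        ; submod = λ where
            zero    → IsSubmodular.submod (contractAll-submodular sub₀ (- η) Fs)
            (suc c) → submod′ c
        ; quotient = λ where
            zero    → contractAll-◁ sub₀ (- η) Fs
            (suc c) → quotient c
        ; concave = λ where
            zero    → top-concave
            (suc c) → concave c
        ; bounded = λ where
            zero X  → ≤-trans (≤-contractAll sub₀ (- η) 0≤η (-‿inverseʳ η) Fs X) (+-monoʳ-≤ (top X) ∣Fs∣η≤p)
            (suc c) → bounded c
        }
        where open T.IsLayered T.layered using () renaming (mono to mono′; submod to submod′)

      level₀≤0 : level η 0 ≤ 0#
      level₀≤0 = by (inj₁ 0<t ⊹ ≤-reflexive (-‿inverseʳ t))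
        (solve 2 (λ t t⁻ → (id ⊕ t⁻) ⊕ (t ⊕ id) ⊜ id ⊕ (id ⊕ (t ⊕ t⁻))) refl t (- t))

      -- Induction with a variable bound `v`: passing to `X ∪ G` raises `v` by `η`, which uses up
      -- one `η` of the slack below `f̂ X - t`. The bound by `f (X ∪ G)` survives because `G ∈ 𝓜`
      -- gives `f̂ X ≤ f (X ∪ G)`.
      ≤-contractAll-trunc : ∀ Gs → (∀ {F} → F ∈ Gs → 𝓜 F) → ∀ X v →
        v ≤ f X → v + length Gs · η ≤ f̂ X + level η 0 → v ≤ contractAll (- η) Gs (trunc (level η 0)) X
      ≤-contractAll-trunc []       _   X v v≤f v≤f̂ = ⊓-glb v≤f (subst (_≤ _) (+-identityʳ v) v≤f̂)
      ≤-contractAll-trunc (G ∷ Gs) all X v v≤f v≤f̂ = ⊓-glb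
        (≤-contractAll-trunc Gs all′ X v v≤f (by (v≤f̂ ⊹ 0≤η)
          (solve 4 (λ v l η u → (v ⊕ l) ⊕ (u ⊕ η) ⊜ u ⊕ ((v ⊕ (η ⊕ l)) ⊕ id)) refl v (length Gs · η) η (f̂ X + level η 0))))
        (by (≤-contractAll-trunc Gs all′ (X ∪ G) (v + η)
              (by (·-nonneg (length Gs) 0≤η ⊹ v≤f̂ ⊹ f̂-≤ (all (here refl)) X ⊹ level₀≤0)
                (solve 6 (λ v l η g s u → (v ⊕ η) ⊕ (l ⊕ ((g ⊕ s) ⊕ (u ⊕ id))) ⊜ u ⊕ (id ⊕ ((v ⊕ (η ⊕ l)) ⊕ (g ⊕ s)))) refl
                  v (length Gs · η) η (f̂ X) (level η 0) (f (X ∪ G))))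
              (by (v≤f̂ ⊹ f̂-mono (p⊆p∪q G))
                (solve 6 (λ v l η g s u → ((v ⊕ η) ⊕ l) ⊕ ((g ⊕ s) ⊕ u) ⊜ (u ⊕ s) ⊕ ((v ⊕ (η ⊕ l)) ⊕ g)) refl
                  v (length Gs · η) η (f̂ X) (level η 0) (f̂ (X ∪ G))))
             ⊹ ≤-reflexive (sym (-‿inverseʳ η)))
          (solve 4 (λ v η η⁻ c → v ⊕ (c ⊕ (η ⊕ η⁻)) ⊜ (c ⊕ η⁻) ⊕ ((v ⊕ η) ⊕ id)) refl
            v η (- η) (contractAll (- η) Gs (trunc (level η 0)) (X ∪ G))))
        where
        all′ : ∀ {F} → F ∈ Gs → 𝓜 F
        all′ F∈ = all (there F∈)

      -- Makes the pool independent over `L`: the gap `t + p` covers the level, at worst `- t`, and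
      -- the contractions, at worst `p`.
      f≤pool : ∀ {L} → f L + (t + p) ≤ f̂ L → ∀ c → f L ≤ pool c L
      f≤pool {L} fL+t+p≤f̂L zero = ≤-contractAll-trunc Fs sound L (f L) ≤-refl
        (by (fL+t+p≤f̂L ⊹ ∣Fs∣η≤p ⊹ ≤-reflexive (sym (-‿inverseʳ t)))
          (solve 6 (λ x l g p t t⁻ → (x ⊕ l) ⊕ (g ⊕ (p ⊕ (t ⊕ t⁻))) ⊜ (g ⊕ (id ⊕ t⁻)) ⊕ ((x ⊕ (t ⊕ p)) ⊕ (l ⊕ id))) refl
            (f L) (length Fs · η) (f̂ L) p t (- t)))
      f≤pool {L} fL+t+p≤f̂L (suc c) = ⊓-glb ≤-refl
        (by (fL+t+p≤f̂L ⊹ ≤-trans 0≤η η≤p ⊹ 0≤t+level 0≤η c)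
          (solve 5 (λ x g p t l → x ⊕ (g ⊕ (p ⊕ (t ⊕ l))) ⊜ (g ⊕ l) ⊕ ((x ⊕ (t ⊕ p)) ⊕ (id ⊕ id))) refl
            (f L) (f̂ L) p t (level η c)))

-- Enlarging pool subsets; enumerating and deciding subsets.

add-one : ∀ {n c} (S : Subset n) → missing S ≡ suc c → ∃ λ T → S ∩ T ≡ S × missing T ≡ c
add-one (true  ∷ S) eq with add-one S eq
... | T , S∩T≡S , eq′ = true ∷ T , cong (true ∷_) S∩T≡S , eq′
add-one (false ∷ S) eq = true ∷ S , cong (false ∷_) (∩-idem S) , ℕ.suc-injective eq

-- Supplies the two larger sets to which the descent applies submodularity.
add-two-ways : ∀ {n c} (S : Subset n) → missing S ≡ suc (suc c) →
               ∃₂ λ T U → T ∩ U ≡ S × missing T ≡ suc c × missing U ≡ suc c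
add-two-ways (true  ∷ S) eq with add-two-ways S eq
... | T , U , T∩U≡S , eqT , eqU = true ∷ T , true ∷ U , cong (true ∷_) T∩U≡S , eqT , eqU
add-two-ways (false ∷ S) eq with add-one S (ℕ.suc-injective eq)
... | T , S∩T≡S , eqT = true ∷ S , false ∷ T , cong (false ∷_) S∩T≡S , ℕ.suc-injective eq , cong suc eqT

allSubsets : ∀ n → List (Subset n)
allSubsets zero    = [] ∷ []
allSubsets (suc n) = List.map (true ∷_) (allSubsets n) List.++ List.map (false ∷_) (allSubsets n)

∈-allSubsets : ∀ {n} (S : Subset n) → S ∈ allSubsets n
∈-allSubsets []          = here refl
∈-allSubsets (true ∷ S)  = ∈-++⁺ˡ (∈-map⁺ (true ∷_) (∈-allSubsets S))
∈-allSubsets (false ∷ S) = ∈-++⁺ʳ _ (∈-map⁺ (false ∷_) (∈-allSubsets S))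

-- Excluded middle holds under double negation, and only finitely many instances are needed. As
-- non-stickiness is a negation, an arbitrary modular cut may thus be taken as decidable.
¬¬-decidable : ∀ {n} (P : Subset n → Set) → ¬ ¬ (∀ S → Dec (P S))
¬¬-decidable {zero}  P ¬dec = ¬¬-excluded-middle λ dec → ¬dec λ where [] → dec
¬¬-decidable {suc n} P ¬dec =
  ¬¬-decidable (λ S → P (true ∷ S)) λ dec₁ → ¬¬-decidable (λ S → P (false ∷ S)) λ dec₀ →
  ¬dec λ where (true ∷ S)  → dec₁ S
               (false ∷ S) → dec₀ S

-- A pair of least defect in a non-principal modular cut.

module _ (ℝ : RealField) where
  open Reals ℝ
  open Poly ℝ

  argmin : ∀ {A : Set} (φ : A → Carrier) x xs → ∃ λ y → y ∈ x ∷ xs × (∀ {z} → z ∈ x ∷ xs → φ y ≤ φ z)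
  argmin φ x []        = x , here refl , λ where (here refl) → ≤-refl
  argmin φ x (x′ ∷ xs) with argmin φ x′ xs
  ... | y , y∈ , min with total (φ x) (φ y)
  ... | inj₁ x≤y = x , here refl , λ where (here refl) → ≤-refl
                                           (there z∈)  → ≤-trans x≤y (min z∈)
  ... | inj₂ y≤x = y , there y∈ , λ where (here refl) → y≤x
                                          (there z∈)  → min z∈

  module _ {m : ℕ} {f : Subset m → Carrier} (poly : IsPolymatroid f)
           {𝓜 : Subset m → Set} (cut : IsModularCut f 𝓜) where
    open IsPolymatroid poly
    open IsModularCut cut

    δ-defect : ∀ F G → δ f F G + (f (F ∩ G) + f (F ∪ G)) ≡ f F + f G
    δ-defect F G = begin
      (((f F + f G) + - x) + - y) + (x + y) ≡⟨ solve 5 (λ a x x⁻ y y⁻ → ((a ⊕ x⁻) ⊕ y⁻) ⊕ (x ⊕ y) ⊜ a ⊕ ((x⁻ ⊕ x) ⊕ (y⁻ ⊕ y))) refl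
                                                (f F + f G) x (- x) y (- y) ⟩
      (f F + f G) + ((- x + x) + (- y + y)) ≡⟨ cong (f F + f G +_) (cong₂ _+_ (-‿inverseˡ x) (-‿inverseˡ y)) ⟩
      (f F + f G) + (0# + 0#)               ≡⟨ solve 1 (λ a → a ⊕ (id ⊕ id) ⊜ a) refl (f F + f G) ⟩
      f F + f G                             ∎
      where
      open ≡-Reasoning
      x = f (F ∩ G)
      y = f (F ∪ G)

    δ-nonneg : ∀ F G → 0# ≤ δ f F G
    δ-nonneg F G = by (submodular F G)
      (trans (+-identityˡ _) (sym (δ-defect F G)))

    -- Intersecting the finitely many members one by one yields a least member, which is then the
    -- intersection of all.
    meet-closed⇒principal : (∀ F → Dec (𝓜 F)) → (∀ {F G} → 𝓜 F → 𝓜 G → 𝓜 (F ∩ G)) → IsPrincipal f 𝓜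
    meet-closed⇒principal 𝓜? meet with anySubset? 𝓜?
    ... | no empty      = inj₁ λ F 𝓜F → empty (F , 𝓜F)
    ... | yes (F , 𝓜F) with least (allSubsets m)
      where
      least : ∀ Gs → ∃ λ I → 𝓜 I × (∀ {G} → G ∈ Gs → 𝓜 G → I ⊆ G)
      least []       = F , 𝓜F , λ ()
      least (G ∷ Gs) with least Gs | 𝓜? G
      ... | I , 𝓜I , I⊆ | yes 𝓜G = I ∩ G , meet 𝓜I 𝓜G , λ where
        (here refl) _   → p∩q⊆q I G
        (there G∈)  𝓜G′ → ⊆-trans (p∩q⊆p I G) (I⊆ G∈ 𝓜G′)
      ... | I , 𝓜I , I⊆ | no ¬𝓜G = I , 𝓜I , λ where
        (here refl) 𝓜G → contradiction 𝓜G ¬𝓜G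
        (there G∈)      → I⊆ G∈
    ... | I , 𝓜I , I⊆ = inj₂ λ X isInt → subst 𝓜
      (⊆-antisym (λ {i} i∈I → proj₂ (isInt i) λ G 𝓜G → I⊆ (∈-allSubsets G) 𝓜G i∈I)
                 (λ {i} i∈X → proj₁ (isInt i) i∈X I 𝓜I))
      𝓜I

    LeastDefectPair : Set
    LeastDefectPair =
      ∃₂ λ A B → (𝓜 A × 𝓜 B × ¬ 𝓜 (A ∩ B)) × (∀ {F G} → 𝓜 F → 𝓜 G → ¬ 𝓜 (F ∩ G) → δ f A B ≤ δ f F G)

    -- Without a bad pair the cut would be closed under intersection, hence principal; so the finite
    -- list of bad pairs is nonempty and has a minimiser.
    least-defect-pair : (∀ F → Dec (𝓜 F)) → ¬ IsPrincipal f 𝓜 → LeastDefectPair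
    least-defect-pair 𝓜? ¬principal = go pairs refl
      where
      allPairs = cartesianProduct (allSubsets m) (allSubsets m)
      bad? : ∀ ((F , G) : Subset m × Subset m) → Dec (𝓜 F × 𝓜 G × ¬ 𝓜 (F ∩ G))
      bad? (F , G) = 𝓜? F ×-dec 𝓜? G ×-dec ¬? (𝓜? (F ∩ G))
      pairs = List.filter bad? allPairs
      ∈-pairs : ∀ {F G} → 𝓜 F → 𝓜 G → ¬ 𝓜 (F ∩ G) → (F , G) ∈ pairs
      ∈-pairs {F} {G} 𝓜F 𝓜G ¬𝓜F∩G =
        ∈-filter⁺ bad? (∈-cartesianProduct⁺ (∈-allSubsets F) (∈-allSubsets G)) (𝓜F , 𝓜G , ¬𝓜F∩G)
      go : ∀ ps → ps ≡ pairs → LeastDefectPair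
      go []       eq = contradiction (meet-closed⇒principal 𝓜? meet) ¬principal
        where
        meet : ∀ {F G} → 𝓜 F → 𝓜 G → 𝓜 (F ∩ G)
        meet {F} {G} 𝓜F 𝓜G with 𝓜? (F ∩ G)
        ... | yes 𝓜F∩G = 𝓜F∩G
        ... | no ¬𝓜F∩G with () ← subst ((F , G) ∈_) (sym eq) (∈-pairs 𝓜F 𝓜G ¬𝓜F∩G)
      go (p ∷ ps) eq with argmin (λ (F , G) → δ f F G) p ps
      ... | (A , B) , AB∈ , min =
        A , B , proj₂ (∈-filter⁻ bad? {xs = allPairs} (subst ((A , B) ∈_) eq AB∈)) ,
        λ 𝓜F 𝓜G ¬𝓜F∩G → min (subst (_ ∈_) (sym eq) (∈-pairs 𝓜F 𝓜G ¬𝓜F∩G))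

    ⊤-member : ∀ {F} → 𝓜 F → 𝓜 ⊤
    ⊤-member {F} 𝓜F = up-close F ⊤ 𝓜F ⊆⊤ λ where
      B (_ , x , _ , x∉⊤) → contradiction (∈⊤ {x = x}) x∉⊤

    -- The gap between `f L + t` and the members above `L`.

    module NonSticky (𝓜? : ∀ F → Dec (𝓜 F)) {A B : Subset m}
      (𝓜A : 𝓜 A) (𝓜B : 𝓜 B) (¬𝓜L : ¬ 𝓜 (A ∩ B))
      (t : Carrier) (0<t : 0# < t) (t-defect : t + (f (A ∩ B) + f (A ∪ B)) ≡ f A + f B)
      (defect : ∀ {F G} → 𝓜 F → 𝓜 G → ¬ 𝓜 (F ∩ G) → t + (f (F ∩ G) + f (F ∪ G)) ≤ f F + f G) where

      L : Subset m
      L = A ∩ B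

      Fs : List (Subset m)
      Fs = List.filter 𝓜? (allSubsets m)

      Fs-sound : ∀ {F} → F ∈ Fs → 𝓜 F
      Fs-sound F∈ = proj₂ (∈-filter⁻ 𝓜? {xs = allSubsets m} F∈)

      Fs-complete : ∀ {F} → 𝓜 F → F ∈ Fs
      Fs-complete {F} 𝓜F = ∈-filter⁺ 𝓜? (∈-allSubsets F) 𝓜F

      open Cut ℝ poly cut 𝓜? (⊤-member 𝓜A) Fs Fs-sound Fs-complete
      open Truncation t 0<t defect

      -- The defect of `F` and `C` is at least `t`, and `f C < f (F ∪ C)` because `C` is a flat not
      -- containing `F`; if it contained `F`, then `F ∩ C` would be the member `F`.
      above-by-flat : ∀ {C F} → 𝓜 C → 𝓜 F → ¬ 𝓜 (F ∩ C) → L ⊆ C → L ⊆ F → f L + t < f F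
      above-by-flat {C} {F} 𝓜C 𝓜F ¬𝓜F∩C L⊆C L⊆F =
        by-< (flats C 𝓜C (F ∪ C) C⊂F∪C ⊹< (defect 𝓜F 𝓜C ¬𝓜F∩C ⊹ monotone L (F ∩ C) (⊆∩ L⊆F L⊆C)))
          (solve 6 (λ l t c u x y → (l ⊕ t) ⊕ (u ⊕ ((x ⊕ c) ⊕ y)) ⊜ x ⊕ (c ⊕ ((t ⊕ (y ⊕ u)) ⊕ l))) refl
            (f L) t (f C) (f (F ∪ C)) (f F) (f (F ∩ C)))
        where
        C⊂F∪C : C ⊂ F ∪ C
        C⊂F∪C with C ⊂? (F ∪ C)
        ... | yes C⊂F∪C = C⊂F∪C
        ... | no  C⊄F∪C = contradiction (subst 𝓜 (sym (p⊆q⇒p∩q≡p F⊆C)) 𝓜F) ¬𝓜F∩C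
          where
          F⊆C : F ⊆ C
          F⊆C {x} x∈F with x ∈? C
          ... | yes x∈C = x∈C
          ... | no  x∉C = ⊥-elim (C⊄F∪C (q⊆p∪q F C , x , p⊆p∪q C x∈F , x∉C))

      above : ∀ {F} → 𝓜 F → L ⊆ F → f L + t < f F
      above {F} 𝓜F L⊆F with 𝓜? (F ∩ A)
      ... | no ¬𝓜F∩A  = above-by-flat 𝓜A 𝓜F ¬𝓜F∩A (p∩q⊆p A B) L⊆F
      -- Now `F ∩ A` is itself a member, and it meets `B` exactly in `L`.
      ... | yes 𝓜F∩A = <-≤-trans
        (above-by-flat 𝓜B 𝓜F∩A (λ 𝓜L → ¬𝓜L (subst 𝓜 F∩A∩B≡L 𝓜L)) (p∩q⊆q A B) (⊆∩ L⊆F (p∩q⊆p A B)))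
        (monotone (F ∩ A) F (p∩q⊆p F A))
        where
        F∩A∩B≡L : (F ∩ A) ∩ B ≡ L
        F∩A∩B≡L = trans (∩-assoc F A B) (trans (∩-comm F L) (p⊆q⇒p∩q≡p L⊆F))

      fL+t<f̂L : f L + t < f̂ L
      fL+t<f̂L with f̂-attained L
      ... | F , 𝓜F , L⊆F , eq = subst (f L + t <_) (sym eq) (above 𝓜F L⊆F)

      -- The two extensions and the impossibility of an amalgam.

      module Amalgam {η p : Carrier} (0≤η : 0# ≤ η) (η≤p : η ≤ p) (∣Fs∣η≤p : length Fs · η ≤ p)
        (fL+t+p≤f̂L : f L + (t + p) ≤ f̂ L) (n : ℕ) (t≤nη : t ≤ n · η) where

        -- A pool of one element of rank `t`: the level is `- t` when it is present and 0 when it is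
        -- missing.
        module Point = TruncLayers {t} {t} (inj₁ 0<t) ≤-refl
        module Pool  = PoolLayers 0≤η η≤p ∣Fs∣η≤p
        open Pool using (pool)

        point-extension : IsExtension f 1 Point.rank
        point-extension = Point.rank-extends Point.layered poly 1 λ X → trunc-full
          (≤-reflexive (sym (trans (cong (_+ - t) (+-identityʳ t)) (-‿inverseʳ t)))) X

        pool-extension : IsExtension f (suc n) Pool.rank
        -- With all `n + 1` elements missing the level is `n · η - t`, because of the shift in
        -- `pool`; it is nonnegative by `t≤nη`.
        pool-extension = Pool.rank-extends Pool.layered poly (suc n) λ X → trunc-full
          (by (t≤nη ⊹ ≤-reflexive (sym (-‿inverseʳ t)))
            (solve 3 (λ a t t⁻ → id ⊕ (a ⊕ (t ⊕ t⁻)) ⊜ (a ⊕ t⁻) ⊕ (t ⊕ id)) refl (n · η) t (- t))) X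

        module _ (h : Subset (m ℕ.+ (1 ℕ.+ suc n)) → Carrier) (h-poly : IsPolymatroid h)
          (h-point : ∀ X b → h (X ++ (b ∷ replicate (suc n) false)) ≡ Point.rank (X ++ (b ∷ [])))
          (h-pool  : ∀ X S → h (X ++ (false ∷ S)) ≡ Pool.rank (X ++ S)) where

          ρ : Subset m → Bool → Subset (suc n) → Carrier
          ρ X b S = h (X ++ (b ∷ S))

          ρ-submod : ∀ X Y b c S T → ρ (X ∩ Y) (b ∧ c) (S ∩ T) + ρ (X ∪ Y) (b ∨ c) (S ∪ T) ≤ ρ X b S + ρ Y c T
          ρ-submod X Y b c S T = subst (_≤ ρ X b S + ρ Y c T)
            (cong₂ (λ V W → h V + h W) (zipWith-++ _∧_ X (b ∷ S) Y (c ∷ T)) (zipWith-++ _∨_ X (b ∷ S) Y (c ∷ T)))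
            (IsPolymatroid.submodular h-poly (X ++ (b ∷ S)) (Y ++ (c ∷ T)))

          ρ-pool : ∀ X S → ρ X false S ≡ pool (missing S) X + ∣ S ∣ · p
          ρ-pool X S = trans (h-pool X S) (Pool.rank-++ X S)

          ρ-point : ∀ X → ρ X true ⊥ ≡ trunc (level t 0) X + (t + 0#)
          ρ-point X = trans (h-point X true) (Point.rank-++ X (true ∷ []))

          ρ-∅ : ∀ X → ρ X false ⊥ ≡ f X
          ρ-∅ X = trans (h-pool X ⊥) (IsExtension.restricts pool-extension X)

          ρ-mono-point : ∀ X S → ρ X false S ≤ ρ X true S
          ρ-mono-point X S = IsPolymatroid.monotone h-poly (X ++ (false ∷ S)) (X ++ (true ∷ S))
            (subst ((X ++ (false ∷ S)) ⊆_)
              (trans (zipWith-++ _∨_ X (false ∷ S) X (true ∷ S)) (cong₂ (λ Y T → Y ++ (true ∷ T)) (∪-idem X) (∪-idem S)))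
              (p⊆p∪q (X ++ (true ∷ S))))

          -- The point adds no rank to `F` alone, and by submodularity none after `S` is added.
          point-in-cl : ∀ {F} → 𝓜 F → ∀ S → ρ F true S ≤ ρ F false S
          point-in-cl {F} 𝓜F S = by
            (subst₂ (λ V W → V + W ≤ ρ F false S + ρ F true ⊥)
              (trans (cong₂ (λ Y T → ρ Y false T) (∩-idem F) (∩-zeroʳ S)) (ρ-∅ F))
              (cong₂ (λ Y T → ρ Y true T) (∪-idem F) (∪-identityʳ S))
              (ρ-submod F F false true S ⊥)
             ⊹ ≤-reflexive (ρ-point F) ⊹ x⊓y≤y (f F) _ ⊹ f̂-≤-⊆ 𝓜F ⊆-refl ⊹ ≤-reflexive (-‿inverseʳ t))
            (solve 8 (λ a b e z g f t t⁻ → a ⊕ ((b ⊕ e) ⊕ ((z ⊕ (t ⊕ id)) ⊕ ((g ⊕ (id ⊕ t⁻)) ⊕ (f ⊕ id)))) ⊜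
                                           b ⊕ ((f ⊕ a) ⊕ (e ⊕ (z ⊕ (g ⊕ (t ⊕ t⁻)))))) refl
              (ρ F true S) (ρ F false S) (ρ F true ⊥) (trunc (level t 0) F) (f̂ F) (f F) t (- t))

          -- With `S` present, `A` and `B` each lose `t` and still contain the point in their
          -- closure, while `A ∪ B` loses at most `t`. The net loss `t` cancels the defect of `A`
          -- and `B`, so submodularity leaves no rank for the point over `L` and `S`.
          nearly-full : ∀ S → missing S ≡ 1 → ρ L true S ≤ f L + ∣ S ∣ · p
          nearly-full S eq = by
            (subst₂ (λ b T → ρ L true T + ρ (A ∪ B) true b ≤ ρ A true S + ρ B true S) (∪-idem S) (∩-idem S)
               (ρ-submod A B true true S S)
             ⊹ in-member 𝓜A ⊹ in-member 𝓜B ⊹ above-union ⊹ ≤-reflexive (sym t-defect) ⊹ ≤-reflexive (-‿inverseʳ t))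
            (solve 11 (λ lS uS aS bS a b u l s t t⁻ →
               lS ⊕ ((aS ⊕ bS) ⊕ ((a ⊕ (t⁻ ⊕ s)) ⊕ ((b ⊕ (t⁻ ⊕ s)) ⊕ (uS ⊕ ((t ⊕ (l ⊕ u)) ⊕ id))))) ⊜
               (l ⊕ s) ⊕ ((lS ⊕ uS) ⊕ (aS ⊕ (bS ⊕ ((u ⊕ (t⁻ ⊕ s)) ⊕ ((a ⊕ b) ⊕ (t ⊕ t⁻))))))) refl
              (ρ L true S) (ρ (A ∪ B) true S) (ρ A true S) (ρ B true S) (f A) (f B) (f (A ∪ B)) (f L) (∣ S ∣ · p) t (- t))
            where
            ρ-S : ∀ X → ρ X false S ≡ trunc (level η 0) X + ∣ S ∣ · p
            ρ-S X = trans (ρ-pool X S) (cong (λ c → pool c X + ∣ S ∣ · p) eq)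
            in-member : ∀ {F} → 𝓜 F → ρ F true S ≤ f F + (- t + ∣ S ∣ · p)
            in-member {F} 𝓜F = by
              (point-in-cl 𝓜F S ⊹ ≤-reflexive (ρ-S F) ⊹ x⊓y≤y (f F) _ ⊹ f̂-≤-⊆ 𝓜F ⊆-refl)
              (solve 7 (λ a b z g f t⁻ s → a ⊕ (b ⊕ ((z ⊕ s) ⊕ ((g ⊕ (id ⊕ t⁻)) ⊕ f))) ⊜
                                           (f ⊕ (t⁻ ⊕ s)) ⊕ (a ⊕ (b ⊕ (z ⊕ g)))) refl
                (ρ F true S) (ρ F false S) (trunc (level η 0) F) (f̂ F) (f F) (- t) (∣ S ∣ · p))
            above-union : f (A ∪ B) + (- t + ∣ S ∣ · p) ≤ ρ (A ∪ B) true S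
            above-union = ≤-trans
              (subst (_≤ trunc (level η 0) (A ∪ B) + ∣ S ∣ · p)
                (solve 3 (λ u t⁻ s → (u ⊕ (id ⊕ t⁻)) ⊕ s ⊜ u ⊕ (t⁻ ⊕ s)) refl (f (A ∪ B)) (- t) (∣ S ∣ · p))
                (+-monoˡ-≤ (∣ S ∣ · p) (⊓-glb
                  (subst (f (A ∪ B) + level η 0 ≤_) (+-identityʳ _) (+-monoʳ-≤ (f (A ∪ B)) Pool.level₀≤0))
                  (+-monoˡ-≤ (level η 0) (f≤f̂ (A ∪ B))))))
              (≤-trans (≤-reflexive (sym (ρ-S (A ∪ B)))) (ρ-mono-point (A ∪ B) S))

          -- Write `S` as `T ∩ U`. The point adds nothing over `L` with `T` or with `U`, and `L`
          -- with `T ∪ U` has its full rank by `f≤pool`, so submodularity passes the bound down to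
          -- `S`. In the first step `T ∪ U` is the complete pool, where the bound concerns `top`.
          descent : ∀ c S → missing S ≡ suc c → ρ L true S ≤ f L + ∣ S ∣ · p
          descent zero    S eq = nearly-full S eq
          descent (suc c) S eq with add-two-ways S eq
          ... | T , U , refl , eqT , eqU = by
            (descent c T eqT ⊹ descent c U eqU
             ⊹ subst₂ (λ Y Z → ρ Y true (T ∩ U) + ρ Z true (T ∪ U) ≤ ρ L true T + ρ L true U) (∩-idem L) (∪-idem L)
                 (ρ-submod L L true true T U)
             ⊹ ρ-mono-point L (T ∪ U) ⊹ ≤-reflexive (sym (ρ-pool L (T ∪ U))) ⊹ Pool.f≤pool fL+t+p≤f̂L (missing (T ∪ U))
             ⊹ ≤-reflexive sizes)
            (solve 11 (λ S T U T∪U T∪U₀ l g a b c d →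
               S ⊕ ((l ⊕ c) ⊕ ((l ⊕ d) ⊕ ((T ⊕ U) ⊕ (T∪U ⊕ (T∪U₀ ⊕ (g ⊕ (a ⊕ b))))))) ⊜
               (l ⊕ a) ⊕ (T ⊕ (U ⊕ ((S ⊕ T∪U) ⊕ (T∪U₀ ⊕ ((g ⊕ b) ⊕ (l ⊕ (c ⊕ d)))))))) refl
              (ρ L true (T ∩ U)) (ρ L true T) (ρ L true U) (ρ L true (T ∪ U)) (ρ L false (T ∪ U)) (f L) (pool (missing (T ∪ U)) L)
              (∣ T ∩ U ∣ · p) (∣ T ∪ U ∣ · p) (∣ T ∣ · p) (∣ U ∣ · p))
            where
            sizes : ∣ T ∣ · p + ∣ U ∣ · p ≡ ∣ T ∩ U ∣ · p + ∣ T ∪ U ∣ · p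
            sizes = trans (sym (×-homo-+ p ∣ T ∣ ∣ U ∣))
              (trans (cong (_· p) (sym (∣p∩q∣+∣p∪q∣≡∣p∣+∣q∣ T U))) (×-homo-+ p ∣ T ∩ U ∣ ∣ T ∪ U ∣))

          -- The descent ends at the empty pool part, where the point adds no rank to `L`; in its
          -- own extension it adds `t`, since `f L ≤ f̂ L - t`.
          no-amalgam : Empty
          no-amalgam = <⇒≱ 0<t (by
            (descent n ⊥ missing-⊥ ⊹ ≤-reflexive (cong (_· p) (∣⊥∣≡0 (suc n)))
             ⊹ ≤-reflexive (sym (ρ-point L)) ⊹ fL≤trunc)
            (solve 5 (λ t e l s z → t ⊕ ((l ⊕ s) ⊕ (id ⊕ (e ⊕ z))) ⊜ id ⊕ (e ⊕ (s ⊕ ((z ⊕ (t ⊕ id)) ⊕ l)))) refl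
              t (ρ L true ⊥) (f L) (∣ ⊥ {suc n} ∣ · p) (trunc (level t 0) L)))
            where
            missing-⊥ : missing (⊥ {suc n}) ≡ suc n
            missing-⊥ = trans (cong (ℕ._+ missing (⊥ {suc n})) (sym (∣⊥∣≡0 (suc n)))) (∣p∣+∣∁p∣≡n ⊥)
            fL≤trunc : f L ≤ trunc (level t 0) L
            fL≤trunc = ⊓-glb ≤-refl (by (inj₁ fL+t<f̂L ⊹ ≤-reflexive (sym (-‿inverseʳ t)))
              (solve 4 (λ l g t t⁻ → l ⊕ (g ⊕ (t ⊕ t⁻)) ⊜ (g ⊕ (id ⊕ t⁻)) ⊕ ((l ⊕ t) ⊕ id)) refl (f L) (f̂ L) t (- t)))

        contradicts-stickiness : ¬ Sticky f
        contradicts-stickiness sticky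
          with sticky 1 (suc n) Point.rank Pool.rank point-extension pool-extension
        ... | h , h-poly , h-point , h-pool = no-amalgam h h-poly (λ X b → h-point X (b ∷ [])) h-pool

      not-sticky : ¬ Sticky f
      not-sticky sticky with difference fL+t<f̂L
      -- `p` is the excess of `f̂ L` over `f L + t`. Taking one more copy of `η` than there are
      -- members yields both `η ≤ p` and `length Fs · η ≤ p`.
      ... | p , 0<p , fL+t+p≡f̂L with small-fraction (length Fs) 0<p
      ... | η , 0<η , Nη≤p = archimedean 0<η λ n → ≰⇒> λ t≤nη →
        Amalgam.contradicts-stickiness 0≤η
          (≤-trans (subst (_≤ η + length Fs · η) (+-identityʳ η) (+-monoʳ-≤ η (·-nonneg (length Fs) 0≤η))) Nη≤p)
          (≤-trans (subst (_≤ η + length Fs · η) (+-identityˡ _) (+-monoˡ-≤ (length Fs · η) 0≤η)) Nη≤p)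
          (≤-reflexive (trans (sym (+-assoc (f L) t p)) fL+t+p≡f̂L)) n t≤nη sticky
        where
        0≤η : 0# ≤ η
        0≤η = inj₁ 0<η

theorem1 : (ℝ : RealField) (m : ℕ) (f : Subset m → RealField.Carrier ℝ) →
    Poly.IsPolymatroid ℝ f → Poly.HasNonPrincipalModularCut ℝ f →
    ¬ Poly.Sticky ℝ f
theorem1 ℝ m f poly (𝓜 , cut , ¬principal) sticky = ¬¬-decidable 𝓜 λ 𝓜? →
  let A , B , (𝓜A , 𝓜B , ¬𝓜A∩B) , least = least-defect-pair ℝ poly cut 𝓜? ¬principal
  in NonSticky.not-sticky ℝ poly cut 𝓜? 𝓜A 𝓜B ¬𝓜A∩B (Poly.δ ℝ f A B)
       -- A zero defect would make `A` and `B` a modular pair and put `A ∩ B` into the cut.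
       (≤∧≢⇒< (δ-nonneg ℝ poly cut A B) λ 0≡δ → ¬𝓜A∩B (modular A B 𝓜A 𝓜B (sym 0≡δ)))
       (δ-defect ℝ poly cut A B)
       (λ {F} {G} 𝓜F 𝓜G ¬𝓜F∩G → ≤-trans (+-monoˡ-≤ _ (least 𝓜F 𝓜G ¬𝓜F∩G)) (≤-reflexive (δ-defect ℝ poly cut F G)))
       sticky
  where
  open Reals ℝ
  open Poly.IsModularCut cut
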